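{- $\text{\ss}_o \leq \max\{\text{\ss},\mathfrak{b}\}$.
   Context: $\mathbb{N}=\{1,2,3,\dots\}$. For $A\subseteq\mathbb{N}$, the subseries $\sum_{n\in A}a_n$ is summed in increasing order of the indices; if $A$ is finite it counts as convergent. A series is conditionally convergent if it converges but not absolutely. A series diverges by oscillation if its partial sums neither converge to a real number nor tend to $+\infty$ nor tend to $-\infty$. The subseries number $\text{\ss}$ is the smallest cardinality of a family $\mathcal{A}$ of subsets of $\mathbb{N}$ such that for every conditionally convergent series $\sum_{n\in\mathbb{N}}a_n$ of real numbers there is $A\in\mathcal{A}$ such that $\sum_{n\in A}a_n$ diverges. $\text{\ss}_o$ is defined in the same way, except that $\sum_{n\in A}a_n$ is required to diverge by oscillation. For $f,g:\mathbb{N}\to\mathbb{N}$, $f\leq^* g$ means $f(n)\leq g(n)$ for all but finitely many $n$. The bounding number $\mathfrak{b}$ is the minimum cardinality of a family $\mathcal{B}$ of functions $\mathbb{N}\to\mathbb{N}$ such that no single $g:\mathbb{N}\to\mathbb{N}$ satisfies $f\leq^* g$ for all $f\in\mathcal{B}$. -}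

module Defs where

open import Data.Bool using (Bool; if_then_else_)
open import Data.Nat as ℕ using (ℕ; zero; suc)
import Data.Nat.Properties as ℕₚ
open import Data.Product using (∃-syntax; Σ-syntax; _×_; _,_; proj₁)
open import Data.Rational as ℚ using (ℚ; 0ℚ; ½)
import Data.Rational.Properties as ℚₚ
open import Data.Rational.Solver using (module +-*-Solver)
open import Data.Sum using (_⊎_; inj₁; inj₂)
open import Function.Bundles using (Func; Injection; Inverse)
open import Level using (Level; 0ℓ; _⊔_) renaming (suc to lsuc)
open import Relation.Binary using (Rel; REL; Setoid; _Respectsˡ_; _Respectsʳ_)
import Relation.Binary.Construct.On as On
open import Relation.Binary.PropositionalEquality
  using (_≡_; refl; sym; trans; cong; subst; _→-setoid_)
open import Relation.Nullary using (¬_)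
open import Relation.Unary using (Pred)

-- Classical foundations.  The theorem is one of ZFC, so it is stated under
-- `ExcludedMiddle` and the following principle.  Because ∃ is a Σ-type, the
-- content of choice lies in the choice function respecting the equality
-- of its domain; for instance every equivalence relation then has a system of
-- representatives.

AxiomOfChoice : ∀ a ℓ₁ b ℓ₂ r → Set (lsuc (a ⊔ ℓ₁ ⊔ b ⊔ ℓ₂ ⊔ r))
AxiomOfChoice a ℓ₁ b ℓ₂ r =
  (S : Setoid a ℓ₁) (T : Setoid b ℓ₂) →
  let module S = Setoid S
      module T = Setoid T in
  (R : REL S.Carrier T.Carrier r) →
  R Respectsˡ S._≈_ → R Respectsʳ T._≈_ →
  (∀ x → ∃[ y ] R x y) →
  ∃[ f ] (∀ x → R x (Func.to {From = S} {To = T} f x))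

-- Real numbers as Cauchy sequences of rationals.  Equality of reals is not
-- needed: every notion below depends only on the order, and `_<_` does not
-- distinguish sequences with the same limit.

IsCauchy : (ℕ → ℚ) → Set
IsCauchy x = ∀ ε → 0ℚ ℚ.< ε →
  ∃[ N ] (∀ m n → N ℕ.≤ m → N ℕ.≤ n → ℚ.∣ x m ℚ.- x n ∣ ℚ.< ε)

record ℝ : Set where
  constructor mkℝ
  field
    seq    : ℕ → ℚ
    cauchy : IsCauchy seq

open ℝ public

private
  half+half : ∀ ε → ε ℚ.* ½ ℚ.+ ε ℚ.* ½ ≡ ε
  half+half ε = trans (sym (ℚₚ.*-distribˡ-+ ε ½ ½)) (ℚₚ.*-identityʳ ε)

  half-pos : ∀ {ε} → 0ℚ ℚ.< ε → 0ℚ ℚ.< ε ℚ.* ½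
  half-pos {ε} 0<ε = subst (ℚ._< ε ℚ.* ½) (ℚₚ.*-zeroˡ ½) (ℚₚ.*-monoˡ-<-pos ½ 0<ε)

  +-interchange : ∀ a b c d →
    (a ℚ.+ b) ℚ.- (c ℚ.+ d) ≡ (a ℚ.- c) ℚ.+ (b ℚ.- d)
  +-interchange = solve 4
    (λ a b c d → (a :+ b) :- (c :+ d) := (a :- c) :+ (b :- d)) refl
    where open +-*-Solver

  neg-minus : ∀ a b → (ℚ.- a) ℚ.- (ℚ.- b) ≡ ℚ.- (a ℚ.- b)
  neg-minus = solve 2 (λ a b → (:- a) :- (:- b) := :- (a :- b)) refl
    where open +-*-Solver

  minus-plus : ∀ a b → (a ℚ.- b) ℚ.+ b ≡ a
  minus-plus = solve 2 (λ a b → (a :- b) :+ b := a) refl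
    where open +-*-Solver

  minus-swap : ∀ a b → b ℚ.- a ≡ ℚ.- (a ℚ.- b)
  minus-swap = solve 2 (λ a b → b :- a := :- (a :- b)) refl
    where open +-*-Solver

  plus-minus : ∀ a b → (a ℚ.+ b) ℚ.- b ≡ a
  plus-minus = solve 2 (λ a b → (a :+ b) :- b := a) refl
    where open +-*-Solver

  ∣p∣-∣q∣≤∣p-q∣ : ∀ p q → ℚ.∣ p ∣ ℚ.- ℚ.∣ q ∣ ℚ.≤ ℚ.∣ p ℚ.- q ∣
  ∣p∣-∣q∣≤∣p-q∣ p q = begin
    ℚ.∣ p ∣ ℚ.- ℚ.∣ q ∣
      ≡⟨ cong (λ t → ℚ.∣ t ∣ ℚ.- ℚ.∣ q ∣) (minus-plus p q) ⟨
    ℚ.∣ (p ℚ.- q) ℚ.+ q ∣ ℚ.- ℚ.∣ q ∣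
      ≤⟨ ℚₚ.+-monoˡ-≤ (ℚ.- ℚ.∣ q ∣) (ℚₚ.∣p+q∣≤∣p∣+∣q∣ (p ℚ.- q) q) ⟩
    (ℚ.∣ p ℚ.- q ∣ ℚ.+ ℚ.∣ q ∣) ℚ.- ℚ.∣ q ∣
      ≡⟨ plus-minus ℚ.∣ p ℚ.- q ∣ ℚ.∣ q ∣ ⟩
    ℚ.∣ p ℚ.- q ∣ ∎
    where open ℚₚ.≤-Reasoning

  ∣∣p∣-∣q∣∣≤∣p-q∣ : ∀ p q → ℚ.∣ ℚ.∣ p ∣ ℚ.- ℚ.∣ q ∣ ∣ ℚ.≤ ℚ.∣ p ℚ.- q ∣
  ∣∣p∣-∣q∣∣≤∣p-q∣ p q with ℚₚ.∣p∣≡p∨∣p∣≡-p (ℚ.∣ p ∣ ℚ.- ℚ.∣ q ∣)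
  ... | inj₁ eq = subst (ℚ._≤ ℚ.∣ p ℚ.- q ∣) (sym eq) (∣p∣-∣q∣≤∣p-q∣ p q)
  ... | inj₂ eq = begin
    ℚ.∣ ℚ.∣ p ∣ ℚ.- ℚ.∣ q ∣ ∣  ≡⟨ eq ⟩
    ℚ.- (ℚ.∣ p ∣ ℚ.- ℚ.∣ q ∣)  ≡⟨ minus-swap ℚ.∣ p ∣ ℚ.∣ q ∣ ⟨
    ℚ.∣ q ∣ ℚ.- ℚ.∣ p ∣        ≤⟨ ∣p∣-∣q∣≤∣p-q∣ q p ⟩
    ℚ.∣ q ℚ.- p ∣              ≡⟨ cong ℚ.∣_∣ (minus-swap p q) ⟩
    ℚ.∣ ℚ.- (p ℚ.- q) ∣        ≡⟨ ℚₚ.∣-p∣≡∣p∣ (p ℚ.- q) ⟩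
    ℚ.∣ p ℚ.- q ∣              ∎
    where open ℚₚ.≤-Reasoning

infixl 6 _+_ _-_
infix  8 -_
infix  4 _<_

fromℚ : ℚ → ℝ
fromℚ q .seq _ = q
fromℚ q .cauchy ε 0<ε =
  0 , λ _ _ _ _ → subst (ℚ._< ε) (sym (cong ℚ.∣_∣ (ℚₚ.+-inverseʳ q))) 0<ε

0ℝ : ℝ
0ℝ = fromℚ 0ℚ

_+_ : ℝ → ℝ → ℝ
(x + y) .seq n = seq x n ℚ.+ seq y n
(x + y) .cauchy ε 0<ε with cauchy x (ε ℚ.* ½) (half-pos 0<ε)
                         | cauchy y (ε ℚ.* ½) (half-pos 0<ε)
... | M , p | N , q = M ℕ.⊔ N , λ m n m≥ n≥ → begin-strict
  ℚ.∣ (seq x m ℚ.+ seq y m) ℚ.- (seq x n ℚ.+ seq y n) ∣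
    ≡⟨ cong ℚ.∣_∣ (+-interchange (seq x m) (seq y m) (seq x n) (seq y n)) ⟩
  ℚ.∣ (seq x m ℚ.- seq x n) ℚ.+ (seq y m ℚ.- seq y n) ∣
    ≤⟨ ℚₚ.∣p+q∣≤∣p∣+∣q∣ (seq x m ℚ.- seq x n) (seq y m ℚ.- seq y n) ⟩
  ℚ.∣ seq x m ℚ.- seq x n ∣ ℚ.+ ℚ.∣ seq y m ℚ.- seq y n ∣
    <⟨ ℚₚ.+-mono-<
         (p m n (ℕₚ.m⊔n≤o⇒m≤o M N m≥) (ℕₚ.m⊔n≤o⇒m≤o M N n≥))
         (q m n (ℕₚ.m⊔n≤o⇒n≤o M N m≥) (ℕₚ.m⊔n≤o⇒n≤o M N n≥)) ⟩
  ε ℚ.* ½ ℚ.+ ε ℚ.* ½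
    ≡⟨ half+half ε ⟩
  ε ∎
  where open ℚₚ.≤-Reasoning

-_ : ℝ → ℝ
(- x) .seq n = ℚ.- seq x n
(- x) .cauchy ε 0<ε with cauchy x ε 0<ε
... | N , p = N , λ m n m≥ n≥ →
  subst (ℚ._< ε)
    (sym (trans (cong ℚ.∣_∣ (neg-minus (seq x m) (seq x n)))
                (ℚₚ.∣-p∣≡∣p∣ (seq x m ℚ.- seq x n))))
    (p m n m≥ n≥)

_-_ : ℝ → ℝ → ℝ
x - y = x + (- y)

∣_∣ : ℝ → ℝ
∣ x ∣ .seq n = ℚ.∣ seq x n ∣
∣ x ∣ .cauchy ε 0<ε with cauchy x ε 0<ε
... | N , p = N , λ m n m≥ n≥ →
  ℚₚ.≤-<-trans (∣∣p∣-∣q∣∣≤∣p-q∣ (seq x m) (seq x n)) (p m n m≥ n≥)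

_<_ : Rel ℝ 0ℓ
x < y = ∃[ δ ] (0ℚ ℚ.< δ × ∃[ N ] (∀ n → N ℕ.≤ n → seq x n ℚ.+ δ ℚ.≤ seq y n))

-- Sequences and series.  The n-th entry of a sequence here is the (n+1)-st in
-- the convention ℕ = {1,2,3,…}.

Tends : (ℕ → ℝ) → ℝ → Set
Tends s L = ∀ ε → 0ℝ < ε → ∃[ N ] (∀ n → N ℕ.≤ n → ∣ s n - L ∣ < ε)

Converges : (ℕ → ℝ) → Set
Converges s = ∃[ L ] Tends s L

TendsTo+∞ : (ℕ → ℝ) → Set
TendsTo+∞ s = ∀ M → ∃[ N ] (∀ n → N ℕ.≤ n → M < s n)

TendsTo-∞ : (ℕ → ℝ) → Set
TendsTo-∞ s = ∀ M → ∃[ N ] (∀ n → N ℕ.≤ n → s n < M)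

partialSum : (ℕ → ℝ) → ℕ → ℝ
partialSum a zero    = 0ℝ
partialSum a (suc n) = partialSum a n + a n

SeriesConverges : (ℕ → ℝ) → Set
SeriesConverges a = Converges (partialSum a)

SeriesDiverges : (ℕ → ℝ) → Set
SeriesDiverges a = ¬ SeriesConverges a

SeriesOscillates : (ℕ → ℝ) → Set
SeriesOscillates a =
  ¬ Converges (partialSum a) × ¬ TendsTo+∞ (partialSum a) × ¬ TendsTo-∞ (partialSum a)

ConditionallyConvergent : (ℕ → ℝ) → Set
ConditionallyConvergent a =
  SeriesConverges a × ¬ SeriesConverges (λ n → ∣ a n ∣)

-- Subsets of ℕ are given by characteristic functions, which under
-- `ExcludedMiddle` are all the subsets.

Subset : Setoid 0ℓ 0ℓ
Subset = ℕ →-setoid Bool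

-- The terms outside A are replaced by 0.  The partial sums are those of
-- Σ_{n∈A} aₙ in increasing order of indices, each repeated finitely often, or
-- eventually constant when A is finite.

subseries : (ℕ → Bool) → (ℕ → ℝ) → (ℕ → ℝ)
subseries A a n = if A n then a n else 0ℝ

-- Cardinal numbers are represented by setoids, compared by injections that
-- respect and reflect equality.

Cardinal : Set₁
Cardinal = Setoid 0ℓ 0ℓ

infix 4 _≤ᶜ_ _≈ᶜ_

_≤ᶜ_ : Cardinal → Cardinal → Set
κ ≤ᶜ μ = Injection κ μ

_≈ᶜ_ : Cardinal → Cardinal → Set
κ ≈ᶜ μ = Inverse κ μ

IsMax : Cardinal → Cardinal → Cardinal → Set
IsMax μ κ ν = (κ ≤ᶜ μ × ν ≤ᶜ μ) × (μ ≈ᶜ κ ⊎ μ ≈ᶜ ν)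

Family : Setoid 0ℓ 0ℓ → Set₁
Family X = Pred (Setoid.Carrier X) 0ℓ

-- Two members of a family are identified when they are equal in X.

card : (X : Setoid 0ℓ 0ℓ) → Family X → Cardinal
card X 𝒜 = On.setoid {B = Σ[ x ∈ Setoid.Carrier X ] 𝒜 x} X proj₁

IsLeastCardinality : (X : Setoid 0ℓ 0ℓ) → (Family X → Set) → Cardinal → Set₁
IsLeastCardinality X P κ =
  (∃[ 𝒜 ] (P 𝒜 × κ ≈ᶜ card X 𝒜)) × (∀ 𝒜 → P 𝒜 → κ ≤ᶜ card X 𝒜)

DivergentSubseriesFamily : Family Subset → Set
DivergentSubseriesFamily 𝒜 =
  ∀ a → ConditionallyConvergent a → ∃[ A ] (𝒜 A × SeriesDiverges (subseries A a))

OscillatingSubseriesFamily : Family Subset → Set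
OscillatingSubseriesFamily 𝒜 =
  ∀ a → ConditionallyConvergent a → ∃[ A ] (𝒜 A × SeriesOscillates (subseries A a))

infix 4 _≤*_

_≤*_ : Rel (ℕ → ℕ) 0ℓ
f ≤* g = ∃[ N ] (∀ n → N ℕ.≤ n → f n ℕ.≤ g n)

UnboundedFamily : Family (ℕ →-setoid ℕ) → Set
UnboundedFamily ℬ = ¬ (∃[ g ] (∀ f → ℬ f → f ≤* g))

IsSubseriesNumber : Cardinal → Set₁
IsSubseriesNumber = IsLeastCardinality Subset DivergentSubseriesFamily

IsOscillatingSubseriesNumber : Cardinal → Set₁
IsOscillatingSubseriesNumber = IsLeastCardinality Subset OscillatingSubseriesFamily

IsBoundingNumber : Cardinal → Set₁
IsBoundingNumber = IsLeastCardinality (ℕ →-setoid ℕ) UnboundedFamily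

{-# OPTIONS --safe #-}
module Submission where

-- Given a conditionally convergent series, some A ∈ 𝒜 makes the subseries over A
-- diverge.  If it does not oscillate, then it tends to +∞ or to -∞, and the
-- subseries over the complement of A tends to the opposite infinity.  A function
-- f ∈ ℬ escaping a suitable bound cuts ℕ into consecutive blocks, infinitely many
-- of which are so long that the sum over A (or over its complement) inside the
-- block outweighs everything before it.  Moving the terms of the series onto the
-- indices of the long blocks and applying the property of 𝒜 again gives X ∈ 𝒜 that
-- both contains and omits infinitely many long blocks.  Using A on the blocks in X
-- and the complement of A on the others yields an oscillating subseries.  The sets
-- so obtained are indexed by 𝒜 × ℬ × 𝒜 × ℕ, which embeds into the maximum because
-- κ × κ ≤ κ for infinite κ.

open import Defs
open import Axiom.ExcludedMiddle using (ExcludedMiddle)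
open import Data.Bool using (Bool; true; false; T; not; if_then_else_)
open import Data.Bool.Properties using (T-irrelevant)
open import Data.Empty using (⊥-elim)
open import Data.Nat as ℕ using (ℕ; zero; suc)
open import Data.Nat.GeneralisedArithmetic using (fold)
import Data.Nat.Properties as ℕₚ
open import Data.Product using (∃; ∃-syntax; Σ-syntax; _×_; _,_; proj₁; proj₂)
open import Data.Product.Function.NonDependent.Propositional using (_×-↣_)
open import Data.Product.Function.NonDependent.Setoid using (_×-injection_)
open import Data.Product.Relation.Binary.Pointwise.NonDependent using (_×ₛ_)
open import Data.Rational as ℚ using (ℚ; 0ℚ; 1ℚ)
import Data.Rational.Properties as ℚₚ
open import Data.Rational.Solver using (module +-*-Solver)
open import Data.Sum using (_⊎_; inj₁; inj₂)
open import Function using (_∘_; id)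
open import Function.Bundles using (Func; Injection; _↣_; mk↣)
import Function.Construct.Composition as Compose
open Compose using (_↣-∘_)
open import Function.Construct.Identity using (↣-id)
import Function.Construct.Symmetry as Symmetry
open import Function.Properties.Inverse using (Inverse⇒Injection)
open import Level using (0ℓ)
open import Relation.Binary using (Setoid; tri<; tri≈; tri>)
open import Relation.Binary.PropositionalEquality
  using (_≡_; refl; sym; trans; cong; cong₂; subst; subst₂; setoid; _→-setoid_; module ≡-Reasoning)
open import Relation.Nullary using (¬_; yes; no; isYes; contradiction)
open import Relation.Nullary.Decidable using (toWitness; fromWitness; decidable-stable)

open Injection using (to; injective)

-- Zorn's lemma

-- Subsets are Boolean-valued, so that the subsets of a small type form a small
-- type; excluded middle turns any predicate into such a subset.

infix 4 _∈_ _⊆_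

_∈_ : {U : Set} → U → (U → Bool) → Set
u ∈ A = T (A u)

_⊆_ : {U : Set} → (U → Bool) → (U → Bool) → Set
A ⊆ B = ∀ u → u ∈ A → u ∈ B

⊆-refl : {U : Set} {A : U → Bool} → A ⊆ A
⊆-refl _ u∈A = u∈A

⊆-trans : {U : Set} {A B C : U → Bool} → A ⊆ B → B ⊆ C → A ⊆ C
⊆-trans A⊆B B⊆C u = B⊆C u ∘ A⊆B u

-- Equality is mutual inclusion, so a choice function on this setoid is extensional; `next-cong`
-- rests on this.
Subsets : Set → Setoid 0ℓ 0ℓ
Subsets U = record
  { Carrier       = U → Bool
  ; _≈_           = λ A B → A ⊆ B × B ⊆ A
  ; isEquivalence = record
    { refl  = ⊆-refl , ⊆-refl
    ; sym   = λ (p , q) → q , p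
    ; trans = λ (p , q) (r , s) → ⊆-trans p r , ⊆-trans s q
    }
  }

module _ (em : ExcludedMiddle 0ℓ) where

  abstract
    separate : {U : Set} → (U → Set) → (U → Bool)
    separate P u = isYes (em {P u})

    ∈-separate⁺ : {U : Set} {P : U → Set} {u : U} → P u → u ∈ separate P
    ∈-separate⁺ {P = P} {u} = fromWitness {a? = em {P u}}

    ∈-separate⁻ : {U : Set} {P : U → Set} {u : U} → u ∈ separate P → P u
    ∈-separate⁻ {P = P} {u} = toWitness {a? = em {P u}}

  ¬¬-elim : {P : Set} → ¬ ¬ P → P
  ¬¬-elim = decidable-stable em

module _ (em : ExcludedMiddle 0ℓ) (ac : AxiomOfChoice 0ℓ 0ℓ 0ℓ 0ℓ 0ℓ) where

  -- Zorn's lemma for families of subsets of U ordered by inclusion: the next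
  -- set is a larger member of P if there is one, and the sets reached from base
  -- by next and by unions form a chain, whose union is maximal.
  module Zorn
    {U : Set} (P : (U → Bool) → Set) (base : U → Bool) (P-base : P base)
    -- A local character: `P` is tested on pairs of elements. This yields both closure under unions
    -- of chains and invariance under mutual inclusion.
    (P-local : ∀ A → ∃[ B ] (P B × B ⊆ A) →
      (∀ u v → u ∈ A → v ∈ A → ∃[ B ] (P B × B ⊆ A × u ∈ B × v ∈ B)) → P A)
    where

    P-resp : ∀ {A B} → A ⊆ B → B ⊆ A → P A → P B
    P-resp {A} {B} A⊆B B⊆A PA = P-local B (A , PA , A⊆B)
      λ u v u∈B v∈B → A , PA , A⊆B , B⊆A u u∈B , B⊆A v v∈B

    -- The last clause makes every fixed point of the step maximal. The clause on `P` is conditional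
    -- so that a step exists at every subset.
    Next : (U → Bool) → (U → Bool) → Set
    Next A B = A ⊆ B × (P A → P B) × (∀ C → P C → A ⊆ C → B ⊆ A → C ⊆ A)

    next-exists : ∀ A → ∃[ B ] Next A B
    next-exists A with em {∃[ C ] (P C × A ⊆ C × ¬ C ⊆ A)}
    ... | yes (C , PC , A⊆C , C⊈A) =
      C , A⊆C , (λ _ → PC) , λ _ _ _ C⊆A → contradiction C⊆A C⊈A
    ... | no none = A , ⊆-refl , id ,
      λ C PC A⊆C _ → ¬¬-elim em λ C⊈A → none (C , PC , A⊆C , C⊈A)

    choice : ∃[ f ] (∀ A → Next A (Func.to {From = Subsets U} {To = Subsets U} f A))
    choice = ac (Subsets U) (Subsets U) Next
      (λ (p , q) (r , s , t) → ⊆-trans q r , (s ∘ P-resp q p) ,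
        λ C PC A⊆C B⊆A → ⊆-trans (t C PC (⊆-trans p A⊆C) (⊆-trans B⊆A q)) p)
      (λ (p , q) (r , s , t) → ⊆-trans r p , (P-resp p q ∘ s) ,
        λ C PC A⊆C B⊆A → t C PC A⊆C (⊆-trans p B⊆A))
      next-exists

    next : (U → Bool) → (U → Bool)
    next = Func.to (proj₁ choice)

    ⊆-next : ∀ {A} → A ⊆ next A
    ⊆-next {A} = proj₁ (proj₂ choice A)

    next-cong : ∀ {A B} → A ⊆ B → B ⊆ A → next A ⊆ next B
    next-cong A⊆B B⊆A = proj₁ (Func.cong (proj₁ choice) (A⊆B , B⊆A))

    ⋃ : ((U → Bool) → Bool) → (U → Bool)
    ⋃ F = separate em λ u → u ∈ base ⊎ ∃[ A ] (A ∈ F × u ∈ A)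

    -- `F` is Boolean-valued, which keeps the tower small enough for its own union `top` to be one
    -- of its members.
    data Tower : (U → Bool) → Set where
      step : ∀ {A} → Tower A → Tower (next A)
      sup  : ∀ F → (∀ A → A ∈ F → Tower A) → Tower (⋃ F)

    ∈-⋃ : ∀ {F A} → A ∈ F → A ⊆ ⋃ F
    ∈-⋃ A∈F u u∈A = ∈-separate⁺ em (inj₂ (_ , A∈F , u∈A))

    base-⊆ : ∀ {A} → Tower A → base ⊆ A
    base-⊆ (step t)  = ⊆-trans (base-⊆ t) ⊆-next
    base-⊆ (sup F _) u u∈base = ∈-separate⁺ em (inj₁ u∈base)

    ⋃-⊆ : ∀ {F B} → Tower B → (∀ A → A ∈ F → A ⊆ B) → ⋃ F ⊆ B
    ⋃-⊆ t A⊆B u u∈⋃ with ∈-separate⁻ em u∈⋃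
    ... | inj₁ u∈base          = base-⊆ t u u∈base
    ... | inj₂ (A , A∈F , u∈A) = A⊆B A A∈F u u∈A

    -- Induction on `A`. By the last hypothesis no step of the tower jumps past `B`: a set inside
    -- `B` either stays inside it after a step, or equals `B`, and then its step contains `next B`.
    compare : ∀ {A B} → Tower A → Tower B →
      (∀ {C} → Tower C → C ⊆ B → B ⊆ C ⊎ next C ⊆ B) → next B ⊆ A ⊎ A ⊆ B
    compare (step t) s h with compare t s h
    ... | inj₁ nB⊆A = inj₁ (⊆-trans nB⊆A ⊆-next)
    ... | inj₂ A⊆B with h t A⊆B
    ...   | inj₁ B⊆A  = inj₁ (next-cong B⊆A A⊆B)
    ...   | inj₂ nA⊆B = inj₂ nA⊆B
    compare {B = B} (sup F t) s h with em {∃[ A ] (A ∈ F × next B ⊆ A)}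
    ... | yes (A , A∈F , nB⊆A) = inj₁ (⊆-trans nB⊆A (∈-⋃ A∈F))
    ... | no none = inj₂ (⋃-⊆ s below)
      where
      below : ∀ A → A ∈ F → A ⊆ B
      below A A∈F with compare (t A A∈F) s h
      ... | inj₁ nB⊆A = contradiction (A , A∈F , nB⊆A) none
      ... | inj₂ A⊆B  = A⊆B

    -- Discharges the hypothesis of `compare` by induction on `B`; inside the induction `compare` is
    -- called only for earlier sets of the tower.
    next-least : ∀ {B} → Tower B → ∀ {A} → Tower A → A ⊆ B → B ⊆ A ⊎ next A ⊆ B
    next-least (step t) s A⊆nB with compare s t (next-least t)
    ... | inj₁ nB⊆A = inj₁ nB⊆A
    ... | inj₂ A⊆B with next-least t s A⊆B
    ...   | inj₁ B⊆A  = inj₂ (next-cong A⊆B B⊆A)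
    ...   | inj₂ nA⊆B = inj₂ (⊆-trans nA⊆B ⊆-next)
    next-least (sup F t) {A} s A⊆⋃ with em {∃[ B ] (B ∈ F × next A ⊆ B)}
    ... | yes (B , B∈F , nA⊆B) = inj₂ (⊆-trans nA⊆B (∈-⋃ B∈F))
    ... | no none = inj₁ (⋃-⊆ s below)
      where
      below : ∀ B → B ∈ F → B ⊆ A
      below B B∈F with compare s (t B B∈F) (next-least (t B B∈F))
      ... | inj₁ nB⊆A = ⊆-trans ⊆-next nB⊆A
      ... | inj₂ A⊆B with next-least (t B B∈F) s A⊆B
      ...   | inj₁ B⊆A  = B⊆A
      ...   | inj₂ nA⊆B = contradiction (B , B∈F , nA⊆B) none

    chain : ∀ {A B} → Tower A → Tower B → A ⊆ B ⊎ B ⊆ A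
    chain t s with compare t s (next-least s)
    ... | inj₁ nB⊆A = inj₂ (⊆-trans ⊆-next nB⊆A)
    ... | inj₂ A⊆B  = inj₁ A⊆B

    -- By `chain`, two elements of a union lie in one common member (or in `base`), which is what
    -- `P-local` asks for.
    Tower-P : ∀ {A} → Tower A → P A
    Tower-P (step {A} t) = proj₁ (proj₂ (proj₂ choice A)) (Tower-P t)
    Tower-P (sup F t) = P-local (⋃ F) (base , P-base , base-⊆ (sup F t)) both
      where
      member : ∀ A → A ∈ F → ∀ {u v} → u ∈ A → v ∈ A →
        ∃[ B ] (P B × B ⊆ ⋃ F × u ∈ B × v ∈ B)
      member A A∈F u∈A v∈A = A , Tower-P (t A A∈F) , ∈-⋃ A∈F , u∈A , v∈A

      both : ∀ u v → u ∈ ⋃ F → v ∈ ⋃ F → ∃[ B ] (P B × B ⊆ ⋃ F × u ∈ B × v ∈ B)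
      both u v u∈ v∈ with ∈-separate⁻ em u∈ | ∈-separate⁻ em v∈
      ... | inj₁ p             | inj₁ q             = base , P-base , base-⊆ (sup F t) , p , q
      ... | inj₁ p             | inj₂ (A , A∈F , q) = member A A∈F (base-⊆ (t A A∈F) u p) q
      ... | inj₂ (A , A∈F , p) | inj₁ q             = member A A∈F p (base-⊆ (t A A∈F) v q)
      ... | inj₂ (A , A∈F , p) | inj₂ (B , B∈F , q) with chain (t A A∈F) (t B B∈F)
      ...   | inj₁ A⊆B = member B B∈F (A⊆B u p) q
      ...   | inj₂ B⊆A = member A A∈F p (B⊆A v q)

    maximal : ∃[ A ] (P A × base ⊆ A × (∀ B → P B → A ⊆ B → B ⊆ A))
    maximal = top , Tower-P top-tower , base-⊆ top-tower ,
      -- `next top` is again in the tower, hence inside its union `top`; so `top` is a fixed point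
      -- of the step.
      λ B PB top⊆B → proj₂ (proj₂ (proj₂ choice top)) B PB top⊆B
        (∈-⋃ (∈-separate⁺ em (step top-tower)))
      where
      top : U → Bool
      top = ⋃ (separate em Tower)

      top-tower : Tower top
      top-tower = sup (separate em Tower) λ A → ∈-separate⁻ em

  -- A maximal partial bijection is total on one of the two sides: otherwise an unmatched `a` and an
  -- unmatched `b` could be paired.
  ↣-total : (A B : Set) → (A ↣ B) ⊎ (B ↣ A)
  ↣-total A B = result
    where
    Matching : (A × B → Bool) → Set
    Matching R = ∀ u v → u ∈ R → v ∈ R →
      (proj₁ u ≡ proj₁ v → proj₂ u ≡ proj₂ v) × (proj₂ u ≡ proj₂ v → proj₁ u ≡ proj₁ v)

    matching-local : ∀ R → ∃[ S ] (Matching S × S ⊆ R) →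
      (∀ u v → u ∈ R → v ∈ R → ∃[ S ] (Matching S × S ⊆ R × u ∈ S × v ∈ S)) → Matching R
    matching-local R _ both u v u∈R v∈R =
      let S , match , _ , u∈S , v∈S = both u v u∈R v∈R in match u v u∈S v∈S

    open Zorn Matching (λ _ → false) (λ _ _ ()) matching-local using (maximal)

    result : (A ↣ B) ⊎ (B ↣ A)
    result with maximal
    ... | R , match , _ , R-max with em {∀ a → ∃[ b ] (a , b) ∈ R} | em {∀ b → ∃[ a ] (a , b) ∈ R}
    ... | yes f | _ = inj₁ (mk↣ {to = λ a → proj₁ (f a)}
          λ {a} {a′} → proj₂ (match _ _ (proj₂ (f a)) (proj₂ (f a′))))
    ... | no _ | yes g = inj₂ (mk↣ {to = λ b → proj₁ (g b)}
          λ {b} {b′} → proj₁ (match _ _ (proj₂ (g b)) (proj₂ (g b′))))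
    ... | no ¬f | no ¬g = ⊥-elim (¬f λ a → ¬¬-elim em λ a∉ → ¬g λ b → ¬¬-elim em λ b∉ →
          a∉ (b , R-max (extend a b) (extend-match a b a∉ b∉)
                    (λ u u∈R → ∈-separate⁺ em (inj₁ u∈R)) (a , b) (∈-separate⁺ em (inj₂ refl))))
      where
      extend : A → B → A × B → Bool
      extend a b = separate em λ u → u ∈ R ⊎ u ≡ (a , b)

      extend-match : ∀ a b → ¬ (∃[ b′ ] (a , b′) ∈ R) → ¬ (∃[ a′ ] (a′ , b) ∈ R) →
        Matching (extend a b)
      extend-match a b a∉ b∉ u v u∈ v∈ with ∈-separate⁻ em u∈ | ∈-separate⁻ em v∈
      ... | inj₁ p    | inj₁ q    = match u v p q
      ... | inj₁ p    | inj₂ refl = (λ { refl → contradiction (_ , p) a∉ })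
                                  , (λ { refl → contradiction (_ , p) b∉ })
      ... | inj₂ refl | inj₁ q    = (λ { refl → contradiction (_ , q) a∉ })
                                  , (λ { refl → contradiction (_ , q) b∉ })
      ... | inj₂ refl | inj₂ refl = (λ _ → refl) , (λ _ → refl)

-- Products of infinite cardinals

-- With s = m + n, the code lies between s² and s² + s because m ≤ s. These intervals are disjoint
-- for distinct s, so the code determines s, then m, then n.
ℕ×ℕ↣ℕ : (ℕ × ℕ) ↣ ℕ
ℕ×ℕ↣ℕ = mk↣ {to = code} λ {p} {q} → code-injective p q
  where
  code : ℕ × ℕ → ℕ
  code (m , n) = (m ℕ.+ n) ℕ.* (m ℕ.+ n) ℕ.+ m

  code-< : ∀ m n m′ n′ → m ℕ.+ n ℕ.< m′ ℕ.+ n′ → code (m , n) ℕ.< code (m′ , n′)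
  code-< m n m′ n′ s<s′ = begin-strict
    s ℕ.* s ℕ.+ m               ≤⟨ ℕₚ.+-monoʳ-≤ (s ℕ.* s) (ℕₚ.m≤m+n m n) ⟩
    s ℕ.* s ℕ.+ s               ≡⟨ ℕₚ.+-comm (s ℕ.* s) s ⟩
    suc s ℕ.* s                 <⟨ ℕₚ.*-monoʳ-< (suc s) (ℕₚ.n<1+n s) ⟩
    suc s ℕ.* suc s             ≤⟨ ℕₚ.*-mono-≤ s<s′ s<s′ ⟩
    s′ ℕ.* s′                   ≤⟨ ℕₚ.m≤m+n (s′ ℕ.* s′) m′ ⟩
    s′ ℕ.* s′ ℕ.+ m′            ∎
    where
    open ℕₚ.≤-Reasoning
    s = m ℕ.+ n
    s′ = m′ ℕ.+ n′

  code-injective : ∀ p q → code p ≡ code q → p ≡ q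
  code-injective (m , n) (m′ , n′) eq with ℕₚ.<-cmp (m ℕ.+ n) (m′ ℕ.+ n′)
  ... | tri< s<s′ _ _ = contradiction eq (ℕₚ.<⇒≢ (code-< m n m′ n′ s<s′))
  ... | tri> _ _ s>s′ = contradiction (sym eq) (ℕₚ.<⇒≢ (code-< m′ n′ m n s>s′))
  ... | tri≈ _ s≡s′ _ = cong₂ _,_ m≡m′ (ℕₚ.+-cancelˡ-≡ m n n′ (trans s≡s′ (cong (ℕ._+ n′) (sym m≡m′))))
    where
    m≡m′ : m ≡ m′
    m≡m′ = ℕₚ.+-cancelˡ-≡ (s′ ℕ.* s′) m m′ (trans (cong (λ s → s ℕ.* s ℕ.+ m) (sym s≡s′)) eq)
      where s′ = m′ ℕ.+ n′

module _ (em : ExcludedMiddle 0ℓ) (ac : AxiomOfChoice 0ℓ 0ℓ 0ℓ 0ℓ 0ℓ) where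

  -- Hessenberg's theorem, from a maximal injection Y × Y → Y with Y ⊆ A.  If
  -- A ∖ Y embeds into Y, then so does A.  Otherwise A ∖ Y contains a copy of Y,
  -- onto which the injection could be extended.
  module Hessenberg {A : Set} (ι : ℕ ↣ A) where

    Triples : Set
    Triples = A × A × A

    graph : {W : Set} → (W → A) → (W × W → W) → Triples → Bool
    graph φ G = separate em λ u → ∃[ p ] ∃[ q ] u ≡ (φ p , φ q , φ (G (p , q)))

    base : Triples → Bool
    base = graph (to ι) (to ℕ×ℕ↣ℕ)

    -- A triple (x , y , z) records that the pair (x , y) is sent to z. The set Y is read off the
    -- diagonal, so that the relation alone carries both Y and the injection Y × Y → Y.
    Dom : (Triples → Bool) → A → Set
    Dom R a = ∃[ z ] (a , a , z) ∈ R

    record Pairing (R : Triples → Bool) : Set where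
      field
        functional : ∀ {x y z x′ y′ z′} → (x , y , z) ∈ R → (x′ , y′ , z′) ∈ R →
                     x ≡ x′ → y ≡ y′ → z ≡ z′
        one-one    : ∀ {x y z x′ y′ z′} → (x , y , z) ∈ R → (x′ , y′ , z′) ∈ R →
                     z ≡ z′ → x ≡ x′ × y ≡ y′
        field-Dom  : ∀ {x y z} → (x , y , z) ∈ R → Dom R x × Dom R y × Dom R z
        total      : ∀ {x y} → Dom R x → Dom R y → ∃[ z ] (x , y , z) ∈ R

    open Pairing

    graph-pairing : {W : Set} (φ : W ↣ A) (G : (W × W) ↣ W) → Pairing (graph (to φ) (to G))
    graph-pairing {W} φ G = record
      { functional = func ; one-one = inj ; field-Dom = dom ; total = tot }
      where
      R = graph (to φ) (to G)

      func : ∀ {x y z x′ y′ z′} → (x , y , z) ∈ R → (x′ , y′ , z′) ∈ R →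
             x ≡ x′ → y ≡ y′ → z ≡ z′
      func u∈ v∈ x≡ y≡ with ∈-separate⁻ em u∈ | ∈-separate⁻ em v∈
      ... | p , q , refl | p′ , q′ , refl =
        cong (to φ ∘ to G) (cong₂ _,_ (injective φ x≡) (injective φ y≡))

      inj : ∀ {x y z x′ y′ z′} → (x , y , z) ∈ R → (x′ , y′ , z′) ∈ R →
            z ≡ z′ → x ≡ x′ × y ≡ y′
      inj u∈ v∈ z≡ with ∈-separate⁻ em u∈ | ∈-separate⁻ em v∈
      ... | p , q , refl | p′ , q′ , refl with injective G (injective φ z≡)
      ... | refl = refl , refl

      image : ∀ w → Dom R (to φ w)
      image w = _ , ∈-separate⁺ em (w , w , refl)

      dom : ∀ {x y z} → (x , y , z) ∈ R → Dom R x × Dom R y × Dom R z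
      dom u∈ with ∈-separate⁻ em u∈
      ... | p , q , refl = image p , image q , image (to G (p , q))

      tot : ∀ {x y} → Dom R x → Dom R y → ∃[ z ] (x , y , z) ∈ R
      tot (_ , u∈) (_ , v∈) with ∈-separate⁻ em u∈ | ∈-separate⁻ em v∈
      ... | p , _ , eq | q , _ , eq′ =
        _ , ∈-separate⁺ em (p , q , cong₂ (λ x y → x , y , to φ (to G (p , q)))
              (cong proj₁ eq) (cong proj₁ eq′))

    Dom-mono : ∀ {R S a} → R ⊆ S → Dom R a → Dom S a
    Dom-mono R⊆S (z , u∈R) = z , R⊆S _ u∈R

    -- Each clause has at most two triples among its premises; for `total` these are the diagonal
    -- triples witnessing the two memberships in Y.
    pairing-local : ∀ R → ∃[ S ] (Pairing S × S ⊆ R) →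
      (∀ u v → u ∈ R → v ∈ R → ∃[ S ] (Pairing S × S ⊆ R × u ∈ S × v ∈ S)) → Pairing R
    pairing-local R _ both = record
      { functional = λ u∈ v∈ → let S , PS , _ , u∈S , v∈S = both _ _ u∈ v∈ in
                     functional PS u∈S v∈S
      ; one-one    = λ u∈ v∈ → let S , PS , _ , u∈S , v∈S = both _ _ u∈ v∈ in
                     one-one PS u∈S v∈S
      ; field-Dom  = λ u∈ → let S , PS , S⊆R , u∈S , _ = both _ _ u∈ u∈
                                dx , dy , dz = field-Dom PS u∈S in
                     Dom-mono S⊆R dx , Dom-mono S⊆R dy , Dom-mono S⊆R dz
      ; total      = λ (_ , u∈) (_ , v∈) → let S , PS , S⊆R , u∈S , v∈S = both _ _ u∈ v∈
                                               z , w∈S = total PS (_ , u∈S) (_ , v∈S) in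
                     z , S⊆R _ w∈S
      }

    open Zorn em ac Pairing base (graph-pairing ι ℕ×ℕ↣ℕ) pairing-local using (maximal)

    module Maximal
      (R : Triples → Bool) (pair : Pairing R) (base⊆R : base ⊆ R)
      (R-max : ∀ S → Pairing S → R ⊆ S → S ⊆ R)
      where

      inY : A → Bool
      inY = separate em (Dom R)

      Y Yᶜ : Set
      Y  = Σ[ a ∈ A ] a ∈ inY
      Yᶜ = Σ[ a ∈ A ] ¬ a ∈ inY

      Y-≡ : {x y : Y} → proj₁ x ≡ proj₁ y → x ≡ y
      Y-≡ {x , p} {.x , q} refl = cong (x ,_) (T-irrelevant p q)

      dom : (x : Y) → Dom R (proj₁ x)
      dom (_ , x∈) = ∈-separate⁻ em x∈

      product : (x y : Y) → ∃[ z ] (proj₁ x , proj₁ y , z) ∈ R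
      product x y = total pair (dom x) (dom y)

      Y×Y↣Y : (Y × Y) ↣ Y
      Y×Y↣Y = mk↣ {to = λ (x , y) → proj₁ (product x y) ,
                      ∈-separate⁺ em (proj₂ (proj₂ (field-Dom pair (proj₂ (product x y)))))}
        λ {(x , y)} {(x′ , y′)} eq →
          let x≡ , y≡ = one-one pair (proj₂ (product x y)) (proj₂ (product x′ y′)) (cong proj₁ eq)
          in cong₂ _,_ (Y-≡ x≡) (Y-≡ y≡)

      -- Y contains the copy of ℕ because the relation extends `base`. Two distinct points are what
      -- gives 2·Y ≤ Y·Y ≤ Y below.
      Bool↣Y : Bool ↣ Y
      Bool↣Y = mk↣ {to = f} λ {b} {c} → f-injective b c
        where
        ι∈ : ∀ n → to ι n ∈ inY
        ι∈ n = ∈-separate⁺ em (_ , base⊆R _ (∈-separate⁺ em (n , n , refl)))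

        f : Bool → Y
        f b = let n = if b then 1 else 0 in to ι n , ι∈ n

        f-injective : ∀ b c → f b ≡ f c → b ≡ c
        f-injective false false _  = refl
        f-injective true  true  _  = refl
        f-injective false true  eq with () ← injective ι (cong proj₁ eq)
        f-injective true  false eq with () ← injective ι (cong proj₁ eq)

      Bool×Y↣Y : (Bool × Y) ↣ Y
      Bool×Y↣Y = Y×Y↣Y ↣-∘ (Bool↣Y ×-↣ ↣-id Y)

      A×A↣A : (A × A) ↣ A
      A×A↣A with ↣-total em ac Yᶜ Y
      ... | inj₁ e = mk↣ {to = proj₁} Y-≡ ↣-∘ (Y×Y↣Y ↣-∘ (A↣Y ×-↣ A↣Y))
        where
        A↣Bool×Y : A ↣ (Bool × Y)
        A↣Bool×Y = mk↣ {to = f} f-injective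
          where
          f : A → Bool × Y
          f a with em {a ∈ inY}
          ... | yes a∈ = true , a , a∈
          ... | no a∉  = false , to e (a , a∉)

          f-injective : ∀ {a b} → f a ≡ f b → a ≡ b
          f-injective {a} {b} eq with em {a ∈ inY} | em {b ∈ inY}
          ... | yes _ | yes _ = cong (proj₁ ∘ proj₂) eq
          ... | no _  | no _  = cong proj₁ (injective e (cong proj₂ eq))
          f-injective () | yes _ | no _
          f-injective () | no _  | yes _

        A↣Y : A ↣ Y
        A↣Y = Bool×Y↣Y ↣-∘ A↣Bool×Y
      -- The extension `S` lives on Y together with a disjoint copy of Y. Maximality forces `S` into
      -- `R`, so the point of the copy that corresponds to `y₀` would belong to Y.
      ... | inj₂ e = ⊥-elim (proj₂ (to e y₀) (∈-separate⁺ em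
              (Dom-mono (R-max S (graph-pairing φ G) R⊆S)
                (_ , ∈-separate⁺ em ((false , y₀) , (false , y₀) , refl)))))
        where
        y₀ : Y
        y₀ = to Bool↣Y true

        W : Set
        W = Bool × Y

        φ : W ↣ A
        φ = mk↣ {to = f} λ {v} {w} → f-injective v w
          where
          f : W → A
          f (true  , y) = proj₁ y
          f (false , y) = proj₁ (to e y)

          Yᶜ-≡ : ∀ x y → proj₁ (to e x) ≡ proj₁ (to e y) → to e x ≡ to e y
          Yᶜ-≡ x y eq with to e x | to e y
          Yᶜ-≡ x y refl | a , p | .a , q = cong (a ,_) refl

          f-injective : ∀ v w → f v ≡ f w → v ≡ w
          f-injective (true  , x) (true  , y) eq = cong (true ,_) (Y-≡ eq)
          f-injective (false , x) (false , y) eq = cong (false ,_) (injective e (Yᶜ-≡ x y eq))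
          f-injective (true  , x) (false , y) eq =
            contradiction (subst (_∈ inY) eq (proj₂ x)) (proj₂ (to e y))
          f-injective (false , x) (true  , y) eq =
            contradiction (subst (_∈ inY) (sym eq) (proj₂ y)) (proj₂ (to e x))

        W×W↣Y : (W × W) ↣ Y
        W×W↣Y = Y×Y↣Y ↣-∘ (Bool×Y↣Y ×-↣ Bool×Y↣Y)

        G : (W × W) ↣ W
        G = mk↣ {to = g} λ {u} {v} → g-injective u v
          where
          g : W × W → W
          -- On Y × Y the old injection is kept, which gives `R⊆S`; all other pairs go into the
          -- copy, which has room for the whole of W × W.
          g ((true , x) , (true , y)) = true , to Y×Y↣Y (x , y)
          g w@((true , _) , (false , _)) = false , to W×W↣Y w
          g w@((false , _) , _) = false , to W×W↣Y w

          true-case : ∀ {x y x′ y′} → to Y×Y↣Y (x , y) ≡ to Y×Y↣Y (x′ , y′) →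
            _≡_ {A = W × W} ((true , x) , (true , y)) ((true , x′) , (true , y′))
          true-case eq with injective Y×Y↣Y eq
          ... | refl = refl

          g-injective : ∀ u v → g u ≡ g v → u ≡ v
          g-injective ((true , _) , (true , _)) ((true , _) , (true , _)) eq =
            true-case (cong proj₂ eq)
          g-injective ((true , _) , (true , _)) ((true , _) , (false , _)) ()
          g-injective ((true , _) , (true , _)) ((false , _) , _) ()
          g-injective ((true , _) , (false , _)) ((true , _) , (true , _)) ()
          g-injective ((false , _) , _) ((true , _) , (true , _)) ()
          g-injective ((true , _) , (false , _)) ((true , _) , (false , _)) eq =
            injective W×W↣Y (cong proj₂ eq)
          g-injective ((true , _) , (false , _)) ((false , _) , _) eq =
            injective W×W↣Y (cong proj₂ eq)
          g-injective ((false , _) , _) ((true , _) , (false , _)) eq =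
            injective W×W↣Y (cong proj₂ eq)
          g-injective ((false , _) , _) ((false , _) , _) eq =
            injective W×W↣Y (cong proj₂ eq)

        S : Triples → Bool
        S = graph (to φ) (to G)

        R⊆S : R ⊆ S
        R⊆S (x , y , z) u∈R =
          let dx , dy , _ = field-Dom pair u∈R
              x̂ = x , ∈-separate⁺ em dx
              ŷ = y , ∈-separate⁺ em dy
          in ∈-separate⁺ em ((true , x̂) , (true , ŷ) , cong (λ z → x , y , z)
               (functional pair u∈R (proj₂ (product x̂ ŷ)) refl refl))

    square : (A × A) ↣ A
    square = let R , pair , base⊆R , R-max = maximal in Maximal.A×A↣A R pair base⊆R R-max

  -- Choice into the carrier with propositional equality picks one representative per class. The
  -- representatives form a type to which `Hessenberg` applies.
  ×ₛ-injection : (K : Setoid 0ℓ 0ℓ) → Injection (setoid ℕ) K → Injection (K ×ₛ K) K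
  ×ₛ-injection K ι = record
    { to        = λ (x , y) → proj₁ (to A×A↣A (collapse x , collapse y))
    ; cong      = λ (x≈ , y≈) → K.reflexive (cong proj₁
                    (cong (to A×A↣A) (cong₂ _,_ (collapse-cong x≈) (collapse-cong y≈))))
    ; injective = λ {(x , y)} {(x′ , y′)} eq →
        let both = injective A×A↣A (A-≡ eq)
        in collapse-injective (cong proj₁ both) , collapse-injective (cong proj₂ both)
    }
    where
    module K = Setoid K

    choice : ∃[ f ] (∀ x → x K.≈ Func.to {From = K} {To = setoid K.Carrier} f x)
    choice = ac K (setoid K.Carrier) K._≈_ (λ x≈y → K.trans (K.sym x≈y))
      (λ { refl x≈y → x≈y }) (λ x → x , K.refl)

    rep : K.Carrier → K.Carrier
    rep = Func.to (proj₁ choice)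

    reps : K.Carrier → Bool
    reps = separate em λ x → ∃[ y ] rep y ≡ x

    A : Set
    A = Σ[ x ∈ K.Carrier ] x ∈ reps

    A-≡ : {x y : A} → proj₁ x K.≈ proj₁ y → x ≡ y
    A-≡ {x , p} {y , q} x≈y with ∈-separate⁻ em p | ∈-separate⁻ em q
    ... | x₀ , refl | y₀ , refl with Func.cong (proj₁ choice)
            (K.trans (proj₂ choice x₀) (K.trans x≈y (K.sym (proj₂ choice y₀))))
    ... | eq = lemma eq p q
      where
      lemma : ∀ {x y : K.Carrier} → x ≡ y → (p : x ∈ reps) (q : y ∈ reps) → (x , p) ≡ (y , q)
      lemma refl p q = cong (_ ,_) (T-irrelevant p q)

    collapse : K.Carrier → A
    collapse x = rep x , ∈-separate⁺ em (x , refl)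

    collapse-cong : ∀ {x y} → x K.≈ y → collapse x ≡ collapse y
    collapse-cong {x} {y} x≈y = A-≡ (K.trans (K.sym (proj₂ choice x)) (K.trans x≈y (proj₂ choice y)))

    collapse-injective : ∀ {x y} → collapse x ≡ collapse y → x K.≈ y
    collapse-injective {x} {y} eq = K.trans (proj₂ choice x)
      (K.trans (K.reflexive (cong proj₁ eq)) (K.sym (proj₂ choice y)))

    A×A↣A : (A × A) ↣ A
    A×A↣A = Hessenberg.square (mk↣ {to = collapse ∘ to ι} (injective ι ∘ collapse-injective))

-- Series

InfinitelyMany : (ℕ → Set) → Set
InfinitelyMany P = ∀ N → ∃[ n ] (N ℕ.≤ n × P n)

infix 4 _≈_

-- Finer than equality of reals: the rational sequences agree term by term. The algebraic identities
-- between partial sums hold in this strong sense.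
_≈_ : ℝ → ℝ → Set
x ≈ y = ∀ k → seq x k ≡ seq y k

<-respˡ-≈ : ∀ {x x′ y} → x ≈ x′ → x < y → x′ < y
<-respˡ-≈ {y = y} x≈x′ (δ , 0<δ , N , below) = δ , 0<δ , N ,
  λ k N≤k → subst (λ p → p ℚ.+ δ ℚ.≤ seq y k) (x≈x′ k) (below k N≤k)

tends-along : ∀ {s t L M} (φ : ℕ → ℕ) → (∀ N → ∃[ N′ ] (∀ n → N′ ℕ.≤ n → N ℕ.≤ φ n)) →
  ∀ K → (∀ n → K ℕ.≤ n → t n - M ≈ s (φ n) - L) → Tends s L → Tends t M
tends-along {s} {t} {L} {M} φ φ→∞ K eq s→L ε 0<ε =
  let N , close = s→L ε 0<ε
      N′ , large = φ→∞ N
  in K ℕ.⊔ N′ , λ n n≥ → <-respˡ-≈ {∣ s (φ n) - L ∣} {∣ t n - M ∣} {ε}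
       (λ k → cong ℚ.∣_∣ (sym (eq n (ℕₚ.m⊔n≤o⇒m≤o K N′ n≥) k)))
       (close (φ n) (large n (ℕₚ.m⊔n≤o⇒n≤o K N′ n≥)))

swapʳ : ∀ p q r → (p ℚ.+ q) ℚ.+ r ≡ (p ℚ.+ r) ℚ.+ q
swapʳ = solve 3 (λ p q r → (p :+ q) :+ r := (p :+ r) :+ q) refl
  where open +-*-Solver

-- That is, Σ_{m≤i<n} aᵢ = Σ_{m≤i<n} bᵢ.
partialSum-agree : ∀ a b {m n} → m ℕ.≤′ n → (∀ i → m ℕ.≤ i → i ℕ.< n → a i ≈ b i) →
  partialSum a n + partialSum b m ≈ partialSum b n + partialSum a m
partialSum-agree a b {m} ℕ.≤′-refl _ k =
  ℚₚ.+-comm (seq (partialSum a m) k) (seq (partialSum b m) k)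
partialSum-agree a b {m} (ℕ.≤′-step {n} m≤n) a≈b k = begin
  (A ℚ.+ seq (a n) k) ℚ.+ B₀  ≡⟨ swapʳ A (seq (a n) k) B₀ ⟩
  (A ℚ.+ B₀) ℚ.+ seq (a n) k
    ≡⟨ cong₂ ℚ._+_ (partialSum-agree a b m≤n (λ i m≤i i<n → a≈b i m≤i (ℕₚ.m<n⇒m<1+n i<n)) k)
                   (a≈b n (ℕₚ.≤′⇒≤ m≤n) (ℕₚ.n<1+n n) k) ⟩
  (B ℚ.+ A₀) ℚ.+ seq (b n) k  ≡⟨ swapʳ B A₀ (seq (b n) k) ⟩
  (B ℚ.+ seq (b n) k) ℚ.+ A₀  ∎
  where
  open ≡-Reasoning
  A = seq (partialSum a n) k
  B = seq (partialSum b n) k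
  A₀ = seq (partialSum a m) k
  B₀ = seq (partialSum b m) k

converges-tail : ∀ {a b} N → (∀ n → N ℕ.≤ n → a n ≈ b n) → SeriesConverges a → SeriesConverges b
converges-tail {a} {b} N a≈b (L , s→L) =
  L + (partialSum b N - partialSum a N) ,
  tends-along {partialSum a} {partialSum b} {L} {L + (partialSum b N - partialSum a N)}
    id (λ N → N , λ _ → id) N difference s→L
  where
  difference : ∀ n → N ℕ.≤ n →
    partialSum b n - (L + (partialSum b N - partialSum a N)) ≈ partialSum a n - L
  difference n N≤n k = begin
    B ℚ.- (l ℚ.+ (B₀ ℚ.- A₀))      ≡⟨ rearrange B l B₀ A₀ ⟩
    (B ℚ.+ A₀) ℚ.- (l ℚ.+ B₀)      ≡⟨ cong (ℚ._- (l ℚ.+ B₀))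
      (partialSum-agree a b (ℕₚ.≤⇒≤′ N≤n) (λ i N≤i _ → a≈b i N≤i) k) ⟨
    (A ℚ.+ B₀) ℚ.- (l ℚ.+ B₀)      ≡⟨ cancel A B₀ l ⟩
    A ℚ.- l                        ∎
    where
    open ≡-Reasoning
    A = seq (partialSum a n) k
    B = seq (partialSum b n) k
    A₀ = seq (partialSum a N) k
    B₀ = seq (partialSum b N) k
    l = seq L k
    open +-*-Solver
    rearrange : ∀ B l B₀ A₀ → B ℚ.- (l ℚ.+ (B₀ ℚ.- A₀)) ≡ (B ℚ.+ A₀) ℚ.- (l ℚ.+ B₀)
    rearrange = solve 4 (λ B l B₀ A₀ → B :- (l :+ (B₀ :- A₀)) := (B :+ A₀) :- (l :+ B₀)) refl
    cancel : ∀ A B₀ l → (A ℚ.+ B₀) ℚ.- (l ℚ.+ B₀) ≡ A ℚ.- l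
    cancel = solve 3 (λ A B₀ l → (A :+ B₀) :- (l :+ B₀) := A :- l) refl

zero-converges : SeriesConverges (λ _ → 0ℝ)
zero-converges = 0ℝ , λ ε 0<ε → 0 , λ n _ →
  <-respˡ-≈ {0ℝ} {∣ partialSum (λ _ → 0ℝ) n - 0ℝ ∣} {ε}
    (λ k → cong (λ p → ℚ.∣ p ℚ.- 0ℚ ∣) (sym (vanishes n k))) 0<ε
  where
  vanishes : ∀ n → partialSum (λ _ → 0ℝ) n ≈ 0ℝ
  vanishes zero    k = refl
  vanishes (suc n) k = trans (ℚₚ.+-identityʳ _) (vanishes n k)

-- Spreading a series over a set of indices

count : (ℕ → Bool) → ℕ → ℕ
count G zero    = 0
count G (suc n) = if G n then suc (count G n) else count G n

-- The terms of `a` are placed in order on the elements of `G`, so that a subseries of the result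
-- depends only on the trace of the index set on `G`.
spread : (ℕ → Bool) → (ℕ → ℝ) → ℕ → ℝ
spread G a n = if G n then a (count G n) else 0ℝ

-- The operation is `id` for convergence and the absolute value for absolute convergence.
partialSum-spread : ∀ G a (op : ℝ → ℝ) → op 0ℝ ≈ 0ℝ → ∀ n →
  partialSum (op ∘ spread G a) n ≈ partialSum (op ∘ a) (count G n)
partialSum-spread G a op op-0 zero    k = refl
partialSum-spread G a op op-0 (suc n) k with G n
... | true  = cong (ℚ._+ seq (op (a (count G n))) k) (partialSum-spread G a op op-0 n k)
... | false = trans (cong₂ ℚ._+_ (partialSum-spread G a op op-0 n k) (op-0 k)) (ℚₚ.+-identityʳ _)

count-mono : ∀ G {m n} → m ℕ.≤′ n → count G m ℕ.≤ count G n
count-mono G ℕ.≤′-refl = ℕₚ.≤-refl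
count-mono G (ℕ.≤′-step {n} m≤n) with G n
... | true  = ℕₚ.m≤n⇒m≤1+n (count-mono G m≤n)
... | false = count-mono G m≤n

count-≤ : ∀ G n → count G n ℕ.≤ n
count-≤ G zero = ℕ.z≤n
count-≤ G (suc n) with G n
... | true  = ℕ.s≤s (count-≤ G n)
... | false = ℕₚ.m≤n⇒m≤1+n (count-≤ G n)

count-suc : ∀ G n → T (G n) → count G (suc n) ≡ suc (count G n)
count-suc G n n∈G with G n
... | true = refl

count-suc-≤ : ∀ G n → count G (suc n) ℕ.≤ suc (count G n)
count-suc-≤ G n with G n
... | true  = ℕₚ.≤-refl
... | false = ℕₚ.n≤1+n _

count-attains : ∀ G n {m} → m ℕ.≤ count G n → ∃[ i ] count G i ≡ m
count-attains G zero m≤0 = 0 , sym (ℕₚ.n≤0⇒n≡0 m≤0)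
count-attains G (suc n) m≤ with ℕₚ.m≤n⇒m<n∨m≡n m≤
... | inj₂ m≡ = suc n , sym m≡
... | inj₁ m< = count-attains G n (ℕ.s≤s⁻¹ (ℕₚ.≤-trans m< (count-suc-≤ G n)))

count-unbounded : ∀ G → InfinitelyMany (_∈ G) → ∀ m → ∃[ n ] m ℕ.≤ count G n
count-unbounded G G-inf zero    = 0 , ℕ.z≤n
count-unbounded G G-inf (suc m) =
  let n , m≤ = count-unbounded G G-inf m
      i , n≤i , i∈G = G-inf n
  in suc i , subst (suc m ℕ.≤_) (sym (count-suc G i i∈G))
       (ℕ.s≤s (ℕₚ.≤-trans m≤ (count-mono G (ℕₚ.≤⇒≤′ n≤i))))

-- Convergence passes from `a` to the spread series along `count G`. Absolute convergence would pass
-- back along `index`, a right inverse of `count G`.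
spread-conditionallyConvergent : ∀ G → InfinitelyMany (_∈ G) → ∀ a →
  ConditionallyConvergent a → ConditionallyConvergent (spread G a)
spread-conditionallyConvergent G G-inf a ((L , s→L) , not-absolutely) =
  (L , tends-along {partialSum a} {partialSum (spread G a)} {L} {L} (count G) count→∞ 0
         (λ n _ k → cong (ℚ._- seq L k) (partialSum-spread G a id (λ _ → refl) n k)) s→L) ,
  λ (M , s→M) → not-absolutely (M ,
    tends-along {partialSum (∣_∣ ∘ spread G a)} {partialSum (∣_∣ ∘ a)} {M} {M} index
      (λ N → N , λ n N≤n → ℕₚ.≤-trans N≤n (index-large n)) 0
      (λ n _ k → cong (ℚ._- seq M k) (sym (trans
        (partialSum-spread G a ∣_∣ (λ _ → refl) (index n) k)
        (cong (λ i → seq (partialSum (∣_∣ ∘ a) i) k) (count-index n))))) s→M)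
  where
  count→∞ : ∀ N → ∃[ N′ ] (∀ n → N′ ℕ.≤ n → N ℕ.≤ count G n)
  count→∞ N = let N′ , N≤ = count-unbounded G G-inf N in
    N′ , λ n N′≤n → ℕₚ.≤-trans N≤ (count-mono G (ℕₚ.≤⇒≤′ N′≤n))

  attained : ∀ n → ∃[ i ] count G i ≡ n
  attained n = let i , n≤ = count-unbounded G G-inf n in count-attains G i n≤

  index : ℕ → ℕ
  index n = proj₁ (attained n)

  count-index : ∀ n → count G (index n) ≡ n
  count-index n = proj₂ (attained n)

  index-large : ∀ n → n ℕ.≤ index n
  index-large n = subst (ℕ._≤ index n) (count-index n) (count-≤ G (index n))

-- A subseries of the spread series is eventually equal to 0 if X ∩ G is finite,
-- and to the whole series if G ∖ X is finite.
split-by-divergent : ExcludedMiddle 0ℓ → ∀ {G X a} →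
  SeriesConverges (spread G a) → SeriesDiverges (subseries X (spread G a)) →
  InfinitelyMany (λ n → n ∈ G × X n ≡ true) × InfinitelyMany (λ n → n ∈ G × X n ≡ false)
split-by-divergent em {G} {X} {a} b-conv X-div =
  (λ N → ¬¬-elim em λ none → X-div (converges-tail {λ _ → 0ℝ} N (absent N none) zero-converges)) ,
  (λ N → ¬¬-elim em λ none → X-div (converges-tail {spread G a} N (present N none) b-conv))
  where
  absent : ∀ N → ¬ (∃[ n ] (N ℕ.≤ n × n ∈ G × X n ≡ true)) →
    ∀ n → N ℕ.≤ n → 0ℝ ≈ subseries X (spread G a) n
  absent N none n N≤n k with X n in X≡ | G n in G≡
  ... | false | _     = refl
  ... | true  | false = refl
  ... | true  | true  = contradiction (n , N≤n , subst T (sym G≡) _ , X≡) none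

  present : ∀ N → ¬ (∃[ n ] (N ℕ.≤ n × n ∈ G × X n ≡ false)) →
    ∀ n → N ℕ.≤ n → spread G a n ≈ subseries X (spread G a) n
  present N none n N≤n k with X n in X≡ | G n in G≡
  ... | true  | _     = refl
  ... | false | false = refl
  ... | false | true  = contradiction (n , N≤n , subst T (sym G≡) _ , X≡) none

-- Blocks

-- Block k runs from `endpoint f k` up to, but excluding, `endpoint f (suc k)`. The `suc` makes
-- every block nonempty, whatever `f` is.
endpoint : (ℕ → ℕ) → ℕ → ℕ
endpoint f zero    = 0
endpoint f (suc k) = endpoint f k ℕ.+ suc (f k)

endpoint-mono : ∀ f {m n} → m ℕ.≤′ n → endpoint f m ℕ.≤ endpoint f n
endpoint-mono f ℕ.≤′-refl           = ℕₚ.≤-refl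
endpoint-mono f (ℕ.≤′-step {n} m≤n) = ℕₚ.≤-trans (endpoint-mono f m≤n) (ℕₚ.m≤m+n _ _)

endpoint-< : ∀ f k → endpoint f k ℕ.< endpoint f (suc k)
endpoint-< f k = ℕₚ.m<m+n (endpoint f k) ℕₚ.0<1+n

endpoint-large : ∀ f k → k ℕ.≤ endpoint f k
endpoint-large f zero    = ℕ.z≤n
endpoint-large f (suc k) = ℕₚ.≤-<-trans (endpoint-large f k) (endpoint-< f k)

module _ (g : ℕ → ℕ) where

  majorant : ℕ → ℕ
  majorant zero    = g 0
  majorant (suc n) = suc (majorant n ℕ.⊔ g (suc n))

  majorant-≥ : ∀ n → g n ℕ.≤ majorant n
  majorant-≥ zero    = ℕₚ.≤-refl
  majorant-≥ (suc n) = ℕₚ.m≤n⇒m≤1+n (ℕₚ.m≤n⊔m _ _)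

  majorant-inflationary : ∀ n → n ℕ.≤ majorant n
  majorant-inflationary zero    = ℕ.z≤n
  majorant-inflationary (suc n) = ℕ.s≤s (ℕₚ.≤-trans (majorant-inflationary n) (ℕₚ.m≤m⊔n _ _))

  majorant-mono : ∀ {m n} → m ℕ.≤′ n → majorant m ℕ.≤ majorant n
  majorant-mono ℕ.≤′-refl       = ℕₚ.≤-refl
  majorant-mono (ℕ.≤′-step m≤n) =
    ℕₚ.m≤n⇒m≤1+n (ℕₚ.≤-trans (majorant-mono m≤n) (ℕₚ.m≤m⊔n _ _))

  fold-mono : ∀ k {m n} → m ℕ.≤ n → fold m majorant k ℕ.≤ fold n majorant k
  fold-mono zero    m≤n = m≤n
  fold-mono (suc k) m≤n = majorant-mono (ℕₚ.≤⇒≤′ (fold-mono k m≤n))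

  fold-monoʳ : ∀ n {j k} → j ℕ.≤′ k → fold n majorant j ℕ.≤ fold n majorant k
  fold-monoʳ n ℕ.≤′-refl       = ℕₚ.≤-refl
  fold-monoʳ n (ℕ.≤′-step j≤k) = ℕₚ.≤-trans (fold-monoʳ n j≤k) (majorant-inflationary _)

  -- Diagonalises over both the starting point and the number of iterations, and so eventually
  -- dominates every orbit of `majorant`.
  diagonal : ℕ → ℕ
  diagonal n = fold n majorant (suc n)

  -- If all blocks from K on are too short, then the endpoints grow at most like
  -- the iterates of the majorant.
  long-blocks : ExcludedMiddle 0ℓ → ∀ f → ¬ f ≤* diagonal →
    InfinitelyMany (λ k → g (endpoint f k) ℕ.≤ endpoint f (suc k))
  long-blocks em f f≰ K = ¬¬-elim em λ none → f≰ (K ℕ.⊔ endpoint f K , bound none)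
    where
    module _ (none : ¬ (∃[ k ] (K ℕ.≤ k × g (endpoint f k) ℕ.≤ endpoint f (suc k)))) where
      open ℕₚ.≤-Reasoning

      growth : ∀ j → endpoint f (j ℕ.+ K) ℕ.≤ fold (endpoint f K) majorant j
      growth zero    = ℕₚ.≤-refl
      growth (suc j) = begin
        endpoint f (suc j ℕ.+ K)            ≤⟨ ℕₚ.<⇒≤ (ℕₚ.≰⇒> λ long → none (j ℕ.+ K , ℕₚ.m≤n+m K j , long)) ⟩
        g (endpoint f (j ℕ.+ K))            ≤⟨ majorant-≥ _ ⟩
        majorant (endpoint f (j ℕ.+ K))     ≤⟨ majorant-mono (ℕₚ.≤⇒≤′ (growth j)) ⟩
        fold (endpoint f K) majorant (suc j) ∎

      bound : ∀ n → K ℕ.⊔ endpoint f K ℕ.≤ n → f n ℕ.≤ diagonal n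
      bound n ≤n = begin
        f n                                  ≤⟨ ℕₚ.n≤1+n (f n) ⟩
        suc (f n)                            ≤⟨ ℕₚ.m≤n+m (suc (f n)) (endpoint f n) ⟩
        -- From block K on there are `suc j` steps with j = n - K. Both the start `endpoint f K` and
        -- j are at most n, which is what `diagonal n` allows for.
        endpoint f (suc n)                   ≡⟨ cong (endpoint f ∘ suc) (ℕₚ.m∸n+n≡m K≤n) ⟨
        endpoint f (suc j ℕ.+ K)             ≤⟨ growth (suc j) ⟩
        fold (endpoint f K) majorant (suc j) ≤⟨ fold-mono (suc j) (ℕₚ.m⊔n≤o⇒n≤o K _ ≤n) ⟩
        fold n majorant (suc j)              ≤⟨ fold-monoʳ n (ℕₚ.≤⇒≤′ (ℕ.s≤s (ℕₚ.m∸n≤m n K))) ⟩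
        diagonal n                           ∎
        where
        K≤n : K ℕ.≤ n
        K≤n = ℕₚ.m⊔n≤o⇒m≤o K _ ≤n
        j = n ℕ.∸ K

blockOf : (ℕ → ℕ) → ℕ → ℕ
blockOf f zero    = 0
blockOf f (suc n) =
  let k = blockOf f n in if endpoint f (suc k) ℕ.≤ᵇ suc n then suc k else k

blockOf-spec : ∀ f n → endpoint f (blockOf f n) ℕ.≤ n × n ℕ.< endpoint f (suc (blockOf f n))
blockOf-spec f zero = ℕ.z≤n , endpoint-< f 0
blockOf-spec f (suc n) with blockOf f n | blockOf-spec f n
... | k | below , above with endpoint f (suc k) ℕ.≤ᵇ suc n in eq
-- Moving on by one index crosses at most one endpoint, since the next block is nonempty.
...   | true  = ℕₚ.≤ᵇ⇒≤ _ _ (subst T (sym eq) _) , ℕₚ.≤-<-trans above (endpoint-< f (suc k))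
...   | false = ℕₚ.m≤n⇒m≤1+n below ,
  ℕₚ.≰⇒> λ ≤n → subst T eq (ℕₚ.≤⇒≤ᵇ ≤n)

blockOf-unique : ∀ f {n k} → endpoint f k ℕ.≤ n → n ℕ.< endpoint f (suc k) → blockOf f n ≡ k
blockOf-unique f {n} {k} below above with ℕₚ.<-cmp (blockOf f n) k
... | tri≈ _ eq _ = eq
... | tri< lt _ _ = contradiction
  (ℕₚ.≤-trans (endpoint-mono f (ℕₚ.≤⇒≤′ lt)) below) (ℕₚ.<⇒≱ (proj₂ (blockOf-spec f n)))
... | tri> _ _ gt = contradiction
  (ℕₚ.≤-trans (endpoint-mono f (ℕₚ.≤⇒≤′ gt)) (proj₁ (blockOf-spec f n))) (ℕₚ.<⇒≱ above)

splice : (ℕ → Bool) → (ℕ → ℕ) → (ℕ → Bool) → ℕ → Bool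
splice A f X n = if X (blockOf f n) then A n else not (A n)

splice-on-block : ∀ A f X {k} n → endpoint f k ℕ.≤ n → n ℕ.< endpoint f (suc k) →
  splice A f X n ≡ (if X k then A n else not (A n))
splice-on-block A f X n below above =
  cong (λ k → if X k then A n else not (A n)) (blockOf-unique f below above)

endpoint-cong : ∀ {f f′} → (∀ n → f n ≡ f′ n) → ∀ k → endpoint f k ≡ endpoint f′ k
endpoint-cong f≗ zero    = refl
endpoint-cong f≗ (suc k) = cong₂ (λ m n → m ℕ.+ suc n) (endpoint-cong f≗ k) (f≗ k)

blockOf-cong : ∀ {f f′} → (∀ n → f n ≡ f′ n) → ∀ n → blockOf f n ≡ blockOf f′ n
blockOf-cong {f} {f′} f≗ n = sym (blockOf-unique f′
  (subst (ℕ._≤ n) (endpoint-cong f≗ k) (proj₁ (blockOf-spec f n)))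
  (subst (n ℕ.<_) (endpoint-cong f≗ (suc k)) (proj₂ (blockOf-spec f n))))
  where k = blockOf f n

splice-cong : ∀ {A A′ f f′ X X′} → (∀ n → A n ≡ A′ n) → (∀ n → f n ≡ f′ n) → (∀ n → X n ≡ X′ n) →
  ∀ n → splice A f X n ≡ splice A′ f′ X′ n
splice-cong {A′ = A′} {f = f} {X = X} {X′} A≗ f≗ X≗ n
  rewrite A≗ n | sym (blockOf-cong f≗ n) | X≗ (blockOf f n) = refl

-- Oscillation

infix 4 _≤_

_≤_ : ℝ → ℝ → Set
x ≤ y = ∀ k → seq x k ℚ.≤ seq y k

≈⇒≤ : ∀ x y → x ≈ y → x ≤ y
≈⇒≤ x y x≈y k = ℚₚ.≤-reflexive (x≈y k)

<-weaken : ∀ {x x′ y y′} → x′ ≤ x → y ≤ y′ → x < y → x′ < y′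
<-weaken x′≤x y≤y′ (δ , 0<δ , N , below) = δ , 0<δ , N , λ k N≤k →
  ℚₚ.≤-trans (ℚₚ.+-monoˡ-≤ δ (x′≤x k)) (ℚₚ.≤-trans (below k N≤k) (y≤y′ k))

<-shift : ∀ x y z → x < y → x + z < y + z
<-shift x y z (δ , 0<δ , N , below) = δ , 0<δ , N , λ k N≤k →
  subst (ℚ._≤ seq y k ℚ.+ seq z k) (swapʳ (seq x k) δ (seq z k))
    (ℚₚ.+-monoˡ-≤ (seq z k) (below k N≤k))

<-trans : ∀ {x y z} → x < y → y < z → x < z
<-trans {y = y} (δ , 0<δ , M , p) (ε , 0<ε , N , q) = δ , 0<δ , M ℕ.⊔ N , λ k ≤k →
  ℚₚ.≤-trans (p k (ℕₚ.m⊔n≤o⇒m≤o M N ≤k)) (ℚₚ.≤-trans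
    (subst (ℚ._≤ seq y k ℚ.+ ε) (ℚₚ.+-identityʳ _) (ℚₚ.+-monoʳ-≤ (seq y k) (ℚₚ.<⇒≤ 0<ε)))
    (q k (ℕₚ.m⊔n≤o⇒n≤o M N ≤k)))

<-irrefl : ∀ {x} → ¬ x < x
<-irrefl {x} (δ , 0<δ , N , below) = ℚₚ.<-irrefl refl (ℚₚ.<-≤-trans
  (subst (ℚ._< seq x N ℚ.+ δ) (ℚₚ.+-identityʳ _) (ℚₚ.+-monoʳ-< (seq x N) 0<δ))
  (below N ℕₚ.≤-refl))

1ℝ -1ℝ : ℝ
1ℝ  = fromℚ 1ℚ
-1ℝ = fromℚ (ℚ.- 1ℚ)

0<1 : 0ℝ < 1ℝ
0<1 = 1ℚ , ℚₚ.positive⁻¹ 1ℚ , 0 , λ _ _ → ℚₚ.≤-reflexive (ℚₚ.+-identityˡ 1ℚ)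

-1<0 : -1ℝ < 0ℝ
-1<0 = 1ℚ , ℚₚ.positive⁻¹ 1ℚ , 0 , λ _ _ → ℚₚ.≤-reflexive (ℚₚ.+-inverseˡ 1ℚ)

p≤∣p∣ : ∀ p → p ℚ.≤ ℚ.∣ p ∣
p≤∣p∣ p with ℚₚ.≤-total 0ℚ p
... | inj₁ 0≤p = ℚₚ.≤-reflexive (sym (ℚₚ.0≤p⇒∣p∣≡p 0≤p))
... | inj₂ p≤0 = ℚₚ.≤-trans p≤0 (ℚₚ.0≤∣p∣ p)

-∣p∣≤p : ∀ p → ℚ.- ℚ.∣ p ∣ ℚ.≤ p
-∣p∣≤p p = subst₂ (λ x y → ℚ.- x ℚ.≤ y) (ℚₚ.∣-p∣≡∣p∣ p) (neg-involutive p)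
  (ℚₚ.neg-antimono-≤ (p≤∣p∣ (ℚ.- p)))
  where
  neg-involutive : ∀ p → ℚ.- (ℚ.- p) ≡ p
  neg-involutive = solve 1 (λ p → :- (:- p) := p) refl
    where open +-*-Solver

near-upper : ∀ x y → ∣ x - y ∣ < 1ℝ → x < y + 1ℝ
near-upper x y near = <-weaken {∣ x - y ∣ + y} {x} {1ℝ + y} {y + 1ℝ}
  (λ k → ℚₚ.≤-trans (ℚₚ.≤-reflexive (sym (minus-plus (seq x k) (seq y k))))
                    (ℚₚ.+-monoˡ-≤ (seq y k) (p≤∣p∣ (seq x k ℚ.- seq y k))))
  (λ k → ℚₚ.≤-reflexive (ℚₚ.+-comm 1ℚ (seq y k)))
  (<-shift ∣ x - y ∣ 1ℝ y near)
  where
  open +-*-Solver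
  minus-plus : ∀ p q → (p ℚ.- q) ℚ.+ q ≡ p
  minus-plus = solve 2 (λ p q → (p :- q) :+ q := p) refl

near-lower : ∀ x y → ∣ x - y ∣ < 1ℝ → y < x + 1ℝ
near-lower x y near = near-upper y x (<-weaken {∣ x - y ∣} {∣ y - x ∣} {1ℝ} {1ℝ}
  (λ k → ℚₚ.≤-reflexive (trans (cong ℚ.∣_∣ (minus-swap (seq x k) (seq y k)))
                               (ℚₚ.∣-p∣≡∣p∣ (seq x k ℚ.- seq y k))))
  (λ _ → ℚₚ.≤-refl) near)
  where
  open +-*-Solver
  minus-swap : ∀ p q → q ℚ.- p ≡ ℚ.- (p ℚ.- q)
  minus-swap = solve 2 (λ p q → q :- p := :- (p :- q)) refl

complement : (ℕ → Bool) → ℕ → Bool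
complement A = not ∘ A

partialSum-complement : ∀ A a n →
  partialSum (subseries A a) n + partialSum (subseries (complement A) a) n ≈ partialSum a n
partialSum-complement A a zero    k = refl
partialSum-complement A a (suc n) k with A n
... | true  = trans (onLeft (seq (partialSum (subseries A a) n) k) (seq (a n) k) _)
                (cong (ℚ._+ seq (a n) k) (partialSum-complement A a n k))
  where
  open +-*-Solver
  onLeft : ∀ p t q → (p ℚ.+ t) ℚ.+ (q ℚ.+ 0ℚ) ≡ (p ℚ.+ q) ℚ.+ t
  onLeft = solve 3 (λ p t q → (p :+ t) :+ (q :+ con 0ℚ) := (p :+ q) :+ t) refl
... | false = trans (onRight (seq (partialSum (subseries A a) n) k) (seq (a n) k) _)
                (cong (ℚ._+ seq (a n) k) (partialSum-complement A a n k))
  where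
  open +-*-Solver
  onRight : ∀ p t q → (p ℚ.+ 0ℚ) ℚ.+ (q ℚ.+ t) ≡ (p ℚ.+ q) ℚ.+ t
  onRight = solve 3 (λ p t q → (p :+ con 0ℚ) :+ (q :+ t) := (p :+ q) :+ t) refl

module _ (p q s : ℕ → ℝ) (p+q≈s : ∀ n → p n + q n ≈ s n) where

  open +-*-Solver

  remainder : ∀ n → s n - p n ≈ q n
  remainder n k = trans (cong (ℚ._- seq (p n) k) (sym (p+q≈s n k))) (cancel (seq (p n) k) (seq (q n) k))
    where
    cancel : ∀ p q → (p ℚ.+ q) ℚ.- p ≡ q
    cancel = solve 2 (λ p q → (p :+ q) :- p := q) refl

  remainder→-∞ : Converges s → TendsTo+∞ p → TendsTo-∞ q
  remainder→-∞ (L , s→L) p→∞ M =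
    let N , near = s→L 1ℝ 0<1
        -- Eventually `s n` is below L + 1, so the remainder `s n - p n` is below M once `p n`
        -- exceeds L + 1 - M.
        N′ , large = p→∞ (L + 1ℝ - M)
    in N ℕ.⊔ N′ , λ n ≤n → <-trans {q n} {L + 1ℝ - p n} {M}
      (<-weaken {s n - p n} {q n} {L + 1ℝ - p n} {L + 1ℝ - p n}
        (λ k → ℚₚ.≤-reflexive (sym (remainder n k))) (λ _ → ℚₚ.≤-refl)
        (<-shift (s n) (L + 1ℝ) (- p n) (near-upper (s n) L (near n (ℕₚ.m⊔n≤o⇒m≤o N N′ ≤n)))))
      (<-weaken {L + 1ℝ - M + (M - p n)} {L + 1ℝ - p n} {p n + (M - p n)} {M}
        (λ k → ℚₚ.≤-reflexive (left (seq L k) (seq M k) (seq (p n) k)))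
        (λ k → ℚₚ.≤-reflexive (right (seq (p n) k) (seq M k)))
        (<-shift (L + 1ℝ - M) (p n) (M - p n) (large n (ℕₚ.m⊔n≤o⇒n≤o N N′ ≤n))))
    where
    left : ∀ l m p → (l ℚ.+ 1ℚ) ℚ.- p ≡ ((l ℚ.+ 1ℚ) ℚ.- m) ℚ.+ (m ℚ.- p)
    left = solve 3 (λ l m p → (l :+ con 1ℚ) :- p := ((l :+ con 1ℚ) :- m) :+ (m :- p)) refl
    right : ∀ p m → p ℚ.+ (m ℚ.- p) ≡ m
    right = solve 2 (λ p m → p :+ (m :- p) := m) refl

  remainder→+∞ : Converges s → TendsTo-∞ p → TendsTo+∞ q
  remainder→+∞ (L , s→L) p→-∞ M =
    let N , near = s→L 1ℝ 0<1
        N′ , small = p→-∞ (L - 1ℝ - M)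
    in N ℕ.⊔ N′ , λ n ≤n → <-trans {M} {L - 1ℝ - p n} {q n}
      (<-weaken {p n + (M - p n)} {M} {L - 1ℝ - M + (M - p n)} {L - 1ℝ - p n}
        (λ k → ℚₚ.≤-reflexive (right (seq (p n) k) (seq M k)))
        (λ k → ℚₚ.≤-reflexive (left (seq L k) (seq M k) (seq (p n) k)))
        (<-shift (p n) (L - 1ℝ - M) (M - p n) (small n (ℕₚ.m⊔n≤o⇒n≤o N N′ ≤n))))
      (<-weaken {L + (-1ℝ - p n)} {L - 1ℝ - p n} {s n + 1ℝ + (-1ℝ - p n)} {q n}
        (λ k → ℚₚ.≤-reflexive (ℚₚ.+-assoc (seq L k) (ℚ.- 1ℚ) (ℚ.- seq (p n) k)))
        (λ k → ℚₚ.≤-reflexive (trans (drop (seq (s n) k) (seq (p n) k)) (remainder n k)))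
        (<-shift L (s n + 1ℝ) (-1ℝ - p n) (near-lower (s n) L (near n (ℕₚ.m⊔n≤o⇒m≤o N N′ ≤n)))))
    where
    left : ∀ l m p → ((l ℚ.- 1ℚ) ℚ.- m) ℚ.+ (m ℚ.- p) ≡ (l ℚ.- 1ℚ) ℚ.- p
    left = solve 3 (λ l m p → ((l :- con 1ℚ) :- m) :+ (m :- p) := (l :- con 1ℚ) :- p) refl
    right : ∀ p m → m ≡ p ℚ.+ (m ℚ.- p)
    right = solve 2 (λ p m → m := p :+ (m :- p)) refl
    drop : ∀ s p → (s ℚ.+ 1ℚ) ℚ.+ (ℚ.- 1ℚ ℚ.- p) ≡ s ℚ.- p
    drop = solve 2 (λ s p → (s :+ con 1ℚ) :+ (con (ℚ.- 1ℚ) :- p) := s :- p) refl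

-- A limit would lie within 1 of a term above 1 and of a term below -1, hence be both positive and
-- negative.
oscillates : ∀ s → InfinitelyMany (λ n → 1ℝ < s n) → InfinitelyMany (λ n → s n < -1ℝ) →
  ¬ Converges s × ¬ TendsTo+∞ s × ¬ TendsTo-∞ s
oscillates s high low = no-limit , not+∞ , not-∞
  where
  no-limit : ¬ Converges s
  no-limit (L , s→L) =
    let N , near = s→L 1ℝ 0<1
        m , N≤m , 1<sm = high N
        n , N≤n , sn<-1 = low N
    in <-irrefl {0ℝ} (<-trans {0ℝ} {L} {0ℝ}
         (<-weaken {1ℝ - 1ℝ} {0ℝ} {L + 1ℝ - 1ℝ} {L}
           (λ _ → ℚₚ.≤-reflexive (sym (ℚₚ.+-inverseʳ 1ℚ)))
           (λ k → ℚₚ.≤-reflexive (cancel (seq L k)))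
           (<-shift 1ℝ (L + 1ℝ) -1ℝ
             (<-trans {1ℝ} {s m} {L + 1ℝ} 1<sm (near-upper (s m) L (near m N≤m)))))
         (<-trans {L} {s n + 1ℝ} {0ℝ} (near-lower (s n) L (near n N≤n))
           (<-weaken {s n + 1ℝ} {s n + 1ℝ} { -1ℝ + 1ℝ} {0ℝ} (λ _ → ℚₚ.≤-refl)
             (λ _ → ℚₚ.≤-reflexive (ℚₚ.+-inverseˡ 1ℚ))
             (<-shift (s n) -1ℝ 1ℝ sn<-1))))
    where
    cancel : ∀ l → (l ℚ.+ 1ℚ) ℚ.- 1ℚ ≡ l
    cancel = solve 1 (λ l → (l :+ con 1ℚ) :- con 1ℚ := l) refl
      where open +-*-Solver

  not+∞ : ¬ TendsTo+∞ s
  not+∞ s→∞ =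
    let N , positive = s→∞ 0ℝ
        n , N≤n , sn<-1 = low N
    in <-irrefl {0ℝ} (<-trans {0ℝ} {s n} {0ℝ} (positive n N≤n)
         (<-trans {s n} { -1ℝ} {0ℝ} sn<-1 -1<0))

  not-∞ : ¬ TendsTo-∞ s
  not-∞ s→-∞ =
    let N , negative = s→-∞ 0ℝ
        n , N≤n , 1<sn = high N
    in <-irrefl {0ℝ} (<-trans {0ℝ} {1ℝ} {0ℝ} 0<1 (<-trans {1ℝ} {s n} {0ℝ} 1<sn (negative n N≤n)))

AgreeOn : (l r : ℕ) (A B : ℕ → Bool) → Set
AgreeOn l r A B = ∀ n → l ℕ.≤ n → n ℕ.< r → A n ≡ B n

-- The block starts at `l` and stops before `r`. In the application `g l` is an index from which the
-- subsum over `A` outweighs any choice made before `l`.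
LongBlock : (ℕ → ℕ) → (C A : ℕ → Bool) → ℕ → Set
LongBlock g C A r = ∃[ l ] (l ℕ.≤ r × g l ℕ.≤ r × AgreeOn l r C A)

module _ (a : ℕ → ℝ) where

  absSum : ℕ → ℝ
  absSum = partialSum (∣_∣ ∘ a)

  subsum : (ℕ → Bool) → ℕ → ℝ
  subsum A = partialSum (subseries A a)

  ∣subsum∣≤absSum : ∀ A n → ∣ subsum A n ∣ ≤ absSum n
  ∣subsum∣≤absSum A zero    k = ℚₚ.≤-refl
  ∣subsum∣≤absSum A (suc n) k = ℚₚ.≤-trans
    (ℚₚ.∣p+q∣≤∣p∣+∣q∣ (seq (subsum A n) k) (seq (subseries A a n) k))
    (ℚₚ.+-mono-≤ (∣subsum∣≤absSum A n k) term)
    where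
    term : ℚ.∣ seq (subseries A a n) k ∣ ℚ.≤ ℚ.∣ seq (a n) k ∣
    term with A n
    ... | true  = ℚₚ.≤-refl
    ... | false = ℚₚ.0≤∣p∣ (seq (a n) k)

  ∣subsum-subsum∣≤2absSum : ∀ A B n → ∣ subsum A n - subsum B n ∣ ≤ absSum n + absSum n
  ∣subsum-subsum∣≤2absSum A B n k = ℚₚ.≤-trans
    (ℚₚ.∣p-q∣≤∣p∣+∣q∣ (seq (subsum A n) k) (seq (subsum B n) k))
    (ℚₚ.+-mono-≤ (∣subsum∣≤absSum A n k) (∣subsum∣≤absSum B n k))

  -- Enough to outweigh whatever was summed before the index n.
  margin : ℕ → ℝ
  margin n = 1ℝ + (absSum n + absSum n)

  -- Agreement on the block freezes the difference of the two subsums at its value at `l`.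
  subsum-block : ∀ {l r} A C → l ℕ.≤ r → AgreeOn l r C A →
    subsum A r + (subsum C l - subsum A l) ≈ subsum C r
  subsum-block {l} {r} A C l≤r C≡A k = trans
    (regroup (seq (subsum A r) k) (seq (subsum C l) k) (seq (subsum A l) k))
    (trans (cong (ℚ._- seq (subsum A l) k) (sym (partialSum-agree (subseries C a) (subseries A a)
             (ℕₚ.≤⇒≤′ l≤r) (λ n l≤n n<r k → cong (λ b → seq (if b then a n else 0ℝ) k) (C≡A n l≤n n<r)) k)))
           (cancel (seq (subsum C r) k) (seq (subsum A l) k)))
    where
    open +-*-Solver
    regroup : ∀ p q r → p ℚ.+ (q ℚ.- r) ≡ (p ℚ.+ q) ℚ.- r
    regroup = solve 3 (λ p q r → p :+ (q :- r) := (p :+ q) :- r) refl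
    cancel : ∀ p q → (p ℚ.+ q) ℚ.- q ≡ p
    cancel = solve 2 (λ p q → (p :+ q) :- q := p) refl

  block-high : ∀ {l r} P C → l ℕ.≤ r → AgreeOn l r C P → margin l < subsum P r → 1ℝ < subsum C r
  block-high {l} {r} P C l≤r C≡P large =
    <-weaken {margin l + d} {1ℝ} {subsum P r + d} {subsum C r}
      (λ k → subst (ℚ._≤ seq (margin l + d) k) (cancel (seq (absSum l + absSum l) k))
        (ℚₚ.+-monoʳ-≤ (seq (margin l) k)
          (ℚₚ.≤-trans (ℚₚ.neg-antimono-≤ (∣subsum-subsum∣≤2absSum C P l k)) (-∣p∣≤p (seq d k)))))
      (≈⇒≤ (subsum P r + d) (subsum C r) (subsum-block P C l≤r C≡P))
      (<-shift (margin l) (subsum P r) d large)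
    where
    d = subsum C l - subsum P l
    open +-*-Solver
    cancel : ∀ p → (1ℚ ℚ.+ p) ℚ.- p ≡ 1ℚ
    cancel = solve 1 (λ p → (con 1ℚ :+ p) :- p := con 1ℚ) refl

  block-low : ∀ {l r} Q C → l ℕ.≤ r → AgreeOn l r C Q → subsum Q r < - margin l → subsum C r < -1ℝ
  block-low {l} {r} Q C l≤r C≡Q small =
    <-weaken {subsum Q r + d} {subsum C r} { - margin l + d} { -1ℝ}
      (≈⇒≤ (subsum C r) (subsum Q r + d) (λ k → sym (subsum-block Q C l≤r C≡Q k)))
      (λ k → subst (seq (- margin l + d) k ℚ.≤_) (cancel (seq (absSum l + absSum l) k))
        (ℚₚ.+-monoʳ-≤ (seq (- margin l) k)
          (ℚₚ.≤-trans (p≤∣p∣ (seq d k)) (∣subsum-subsum∣≤2absSum C Q l k))))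
      (<-shift (subsum Q r) (- margin l) d small)
    where
    d = subsum C l - subsum Q l
    open +-*-Solver
    cancel : ∀ p → ℚ.- (1ℚ ℚ.+ p) ℚ.+ p ≡ ℚ.- 1ℚ
    cancel = solve 1 (λ p → :- (con 1ℚ :+ p) :+ p := con (ℚ.- 1ℚ)) refl

  module _ (P Q : ℕ → Bool) (P→∞ : TendsTo+∞ (subsum P)) (Q→-∞ : TendsTo-∞ (subsum Q)) where

    -- Depends only on the series, `P` and `Q`, so it is fixed before the blocks are cut. The
    -- maximum lets one notion of long block serve both directions.
    wait : ℕ → ℕ
    wait n = proj₁ (P→∞ (margin n)) ℕ.⊔ proj₁ (Q→-∞ (- margin n))

    blocks-oscillate : ∀ C → InfinitelyMany (LongBlock wait C P) →
      InfinitelyMany (LongBlock wait C Q) → SeriesOscillates (subseries C a)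
    blocks-oscillate C P-blocks Q-blocks = oscillates (subsum C)
      (λ N → let r , N≤r , l , l≤r , long , C≡P = P-blocks N in
        r , N≤r , block-high P C l≤r C≡P
          (proj₂ (P→∞ (margin l)) r (ℕₚ.m⊔n≤o⇒m≤o _ _ long)))
      (λ N → let r , N≤r , l , l≤r , long , C≡Q = Q-blocks N in
        r , N≤r , block-low Q C l≤r C≡Q
          (proj₂ (Q→-∞ (- margin l)) r (ℕₚ.m⊔n≤o⇒n≤o _ _ long)))

-- Cardinalities of families

imageFamily : ∀ {I X : Setoid 0ℓ 0ℓ} → Func I X → Family X
imageFamily {X = X} d x = ∃[ i ] Setoid._≈_ X x (Func.to d i)

-- Choice selects, for each member of the image, the code of an index that produces it; equal codes
-- come from equal indices, hence from equal members.
card-imageFamily-≤ : AxiomOfChoice 0ℓ 0ℓ 0ℓ 0ℓ 0ℓ → ∀ {I X κ : Setoid 0ℓ 0ℓ} (d : Func I X) →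
  I ≤ᶜ κ → card X (imageFamily d) ≤ᶜ κ
card-imageFamily-≤ ac {I} {X} {κ} d code = record
  { to        = Func.to (proj₁ choice)
  ; cong      = Func.cong (proj₁ choice)
  ; injective = λ {x} {y} eq →
      let i , i≈ , x≈ = proj₂ choice x
          j , j≈ , y≈ = proj₂ choice y
      in X.trans x≈ (X.trans (Func.cong d (injective code (κ.trans i≈ (κ.trans eq (κ.sym j≈)))))
           (X.sym y≈))
  }
  where
  module X = Setoid X
  module κ = Setoid κ

  Codes : ∃ (imageFamily d) → κ.Carrier → Set
  Codes (x , _) m = ∃[ i ] (to code i κ.≈ m × x X.≈ Func.to d i)

  choice : ∃[ f ] (∀ x → Codes x (Func.to {From = card X (imageFamily d)} {To = κ} f x))
  choice = ac (card X (imageFamily d)) κ Codes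
    (λ x≈y (i , i≈ , x≈) → i , i≈ , X.trans (X.sym x≈y) x≈)
    (λ m≈n (i , i≈ , x≈) → i , κ.trans i≈ m≈n , x≈)
    (λ (x , i , x≈) → to code i , i , κ.refl , x≈)

module _ (em : ExcludedMiddle 0ℓ) {ℬ : Family (ℕ →-setoid ℕ)} (unbounded : UnboundedFamily ℬ) where

  escaping : ∀ g → ∃[ f ] (ℬ f × ¬ f ≤* g)
  escaping g = ¬¬-elim em λ none → unbounded (g , λ f f∈ℬ →
    ¬¬-elim em λ f≰g → none (f , f∈ℬ , f≰g))

  -- Each new member escapes the pointwise maximum of its predecessors and therefore differs from
  -- all of them.
  ℕ-≤-unbounded : setoid ℕ ≤ᶜ card (ℕ →-setoid ℕ) ℬ
  ℕ-≤-unbounded = record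
    { to        = λ n → member n , proj₁ (proj₂ (escaping (bound n)))
    ; cong      = λ { refl _ → refl }
    ; injective = λ {m} {n} → member-injective m n
    }
    where
    bound : ℕ → ℕ → ℕ
    bound zero    k = 0
    bound (suc n) k = bound n k ℕ.⊔ proj₁ (escaping (bound n)) k

    member : ℕ → ℕ → ℕ
    member n = proj₁ (escaping (bound n))

    member-≤ : ∀ {m n} → suc m ℕ.≤′ n → ∀ k → member m k ℕ.≤ bound n k
    member-≤ ℕ.≤′-refl       k = ℕₚ.m≤n⊔m _ _
    member-≤ (ℕ.≤′-step m<n) k = ℕₚ.≤-trans (member-≤ m<n k) (ℕₚ.m≤m⊔n _ _)

    distinct : ∀ {m n} → m ℕ.< n → ¬ (∀ k → member m k ≡ member n k)
    distinct {m} {n} m<n eq = proj₂ (proj₂ (escaping (bound n)))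
      (0 , λ k _ → subst (ℕ._≤ bound n k) (eq k) (member-≤ (ℕₚ.≤⇒≤′ m<n) k))

    member-injective : ∀ m n → (∀ k → member m k ≡ member n k) → m ≡ n
    member-injective m n eq with ℕₚ.<-cmp m n
    ... | tri< m<n _ _ = contradiction eq (distinct m<n)
    ... | tri≈ _ m≡n _ = m≡n
    ... | tri> _ _ n<m = contradiction (sym ∘ eq) (distinct n<m)

-- Oscillating subseries from spliced sets

module _ (em : ExcludedMiddle 0ℓ) {𝒜 : Family Subset} {ℬ : Family (ℕ →-setoid ℕ)}
  (divergent : DivergentSubseriesFamily 𝒜) (unbounded : UnboundedFamily ℬ) where

  Index : Setoid 0ℓ 0ℓ
  Index = (card Subset 𝒜 ×ₛ card (ℕ →-setoid ℕ) ℬ) ×ₛ (card Subset 𝒜 ×ₛ setoid ℕ)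

  -- The number 0 keeps the members of 𝒜 themselves in the family.
  spliced : Func Index Subset
  spliced = record
    { to   = λ { (((A , _) , _) , (_ , zero)) → A
               ; (((A , _) , (f , _)) , ((X , _) , suc _)) → splice A f X }
    ; cong = λ { {_ , (_ , zero)}  ((A≗ , _) , (_ , refl)) → A≗
               ; {_ , (_ , suc _)} ((A≗ , f≗) , (X≗ , refl)) → splice-cong A≗ f≗ X≗ }
    }

  module _ (a : ℕ → ℝ) (a-cc : ConditionallyConvergent a) where

    -- Thus 𝒜 is a splitting family, which is the inequality between the splitting number and ß: an
    -- `X` that does not split `G` has a convergent subseries of `spread G a`.
    splitting : ∀ G → InfinitelyMany (_∈ G) → ∃[ X ] (𝒜 X ×
      InfinitelyMany (λ n → n ∈ G × X n ≡ true) × InfinitelyMany (λ n → n ∈ G × X n ≡ false))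
    splitting G G-inf =
      let b-cc = spread-conditionallyConvergent G G-inf a a-cc
          X , X∈𝒜 , X-div = divergent (spread G a) b-cc
      in X , X∈𝒜 , split-by-divergent em {a = a} (proj₁ b-cc) X-div

    -- The order of choices matters: `g` determines `f`, `f` determines the blocks, and `X` then
    -- splits the set of numbers k of long blocks, not the indices inside them.
    splice-blocks : ∀ g A → ∃[ f ] ∃[ X ] (ℬ f × 𝒜 X ×
      InfinitelyMany (LongBlock g (splice A f X) A) ×
      InfinitelyMany (LongBlock g (splice A f X) (complement A)))
    splice-blocks g A =
      let f , f∈ℬ , f≰ = escaping em unbounded (diagonal g)
          long : ℕ → Bool
          long k = g (endpoint f k) ℕ.≤ᵇ endpoint f (suc k)
          X , X∈𝒜 , ins , outs = splitting long λ N →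
            let k , N≤k , k-long = long-blocks g em f f≰ N in k , N≤k , ℕₚ.≤⇒≤ᵇ k-long
          block : ∀ k → k ∈ long → ∀ B →
            (∀ n → (if X k then A n else not (A n)) ≡ B n) →
            LongBlock g (splice A f X) B (endpoint f (suc k))
          block k k-long B eq = endpoint f k , ℕₚ.<⇒≤ (endpoint-< f k) , ℕₚ.≤ᵇ⇒≤ _ _ k-long ,
            λ n l≤n n<r → trans (splice-on-block A f X n l≤n n<r) (eq n)
          far : ∀ {N k} → N ℕ.≤ k → N ℕ.≤ endpoint f (suc k)
          far {k = k} N≤k = ℕₚ.≤-trans N≤k (ℕₚ.<⇒≤ (endpoint-large f (suc k)))
      in f , X , f∈ℬ , X∈𝒜 ,
         (λ N → let k , N≤k , k-long , Xk = ins N in _ , far N≤k ,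
            block k k-long A (λ n → cong (if_then A n else not (A n)) Xk)) ,
         (λ N → let k , N≤k , k-long , Xk = outs N in _ , far N≤k ,
            block k k-long (complement A) (λ n → cong (if_then A n else not (A n)) Xk))

    splice-oscillates : ∀ A → TendsTo+∞ (subsum a A) ⊎ TendsTo-∞ (subsum a A) →
      ∃[ f ] ∃[ X ] (ℬ f × 𝒜 X × SeriesOscillates (subseries (splice A f X) a))
    splice-oscillates A (inj₁ A→+∞) =
      let Aᶜ→-∞ = remainder→-∞ (subsum a A) (subsum a (complement A)) (partialSum a)
            (partialSum-complement A a) (proj₁ a-cc) A→+∞
          f , X , f∈ℬ , X∈𝒜 , ins , outs = splice-blocks (wait a A (complement A) A→+∞ Aᶜ→-∞) A
      in f , X , f∈ℬ , X∈𝒜 ,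
         blocks-oscillate a A (complement A) A→+∞ Aᶜ→-∞ (splice A f X) ins outs
    splice-oscillates A (inj₂ A→-∞) =
      let Aᶜ→+∞ = remainder→+∞ (subsum a A) (subsum a (complement A)) (partialSum a)
            (partialSum-complement A a) (proj₁ a-cc) A→-∞
          f , X , f∈ℬ , X∈𝒜 , ins , outs = splice-blocks (wait a (complement A) A Aᶜ→+∞ A→-∞) A
      in f , X , f∈ℬ , X∈𝒜 ,
         -- Here the complement tends to +∞, so the long blocks outside `X` produce the high partial
         -- sums.
         blocks-oscillate a (complement A) A Aᶜ→+∞ A→-∞ (splice A f X) outs ins

  spliced-oscillating : OscillatingSubseriesFamily (imageFamily spliced)
  spliced-oscillating a a-cc with divergent a a-cc
  ... | A , A∈𝒜 , A-div
    with em {TendsTo+∞ (subsum a A)} | em {TendsTo-∞ (subsum a A)}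
  ... | no ¬+∞ | no ¬-∞ =
    -- Escaping `id` supplies a member of ℬ to complete the index, whose last entry 0 selects `A`
    -- itself.
    let f , f∈ℬ , _ = escaping em unbounded id
    in A , ((((A , A∈𝒜) , (f , f∈ℬ)) , ((A , A∈𝒜) , 0)) , λ _ → refl) , A-div , ¬+∞ , ¬-∞
  ... | yes +∞ | _ =
    let f , X , f∈ℬ , X∈𝒜 , osc = splice-oscillates a a-cc A (inj₁ +∞)
    in splice A f X , ((((A , A∈𝒜) , (f , f∈ℬ)) , ((X , X∈𝒜) , 1)) , λ _ → refl) , osc
  ... | no _ | yes -∞ =
    let f , X , f∈ℬ , X∈𝒜 , osc = splice-oscillates a a-cc A (inj₂ -∞)
    in splice A f X , ((((A , A∈𝒜) , (f , f∈ℬ)) , ((X , X∈𝒜) , 1)) , λ _ → refl) , osc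

theorem21 : (∀ {ℓ} → ExcludedMiddle ℓ) →
    (∀ {a ℓ₁ b ℓ₂ r} → AxiomOfChoice a ℓ₁ b ℓ₂ r) →
    ∀ {ßₒ ß 𝔟 max : Cardinal} →
    IsOscillatingSubseriesNumber ßₒ →
    IsSubseriesNumber ß →
    IsBoundingNumber 𝔟 →
    IsMax max ß 𝔟 →
    ßₒ ≤ᶜ max
theorem21 em ac {max = max} (_ , ßₒ-least) ((𝒜 , divergent , ß≈𝒜) , _) ((ℬ , unbounded , 𝔟≈ℬ) , _)
  ((ß≤max , 𝔟≤max) , _) =
  Compose.injection (ßₒ-least _ (spliced-oscillating em divergent unbounded))
    (card-imageFamily-≤ ac (spliced em divergent unbounded) code)
  where
  𝒜≤max : card Subset 𝒜 ≤ᶜ max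
  𝒜≤max = Compose.injection (Inverse⇒Injection (Symmetry.inverse ß≈𝒜)) ß≤max

  ℬ≤max : card (ℕ →-setoid ℕ) ℬ ≤ᶜ max
  ℬ≤max = Compose.injection (Inverse⇒Injection (Symmetry.inverse 𝔟≈ℬ)) 𝔟≤max

  -- The maximum is infinite because 𝔟 is; this is what lets its square embed into it.
  ℕ≤max : setoid ℕ ≤ᶜ max
  ℕ≤max = Compose.injection (ℕ-≤-unbounded em unbounded) ℬ≤max

  pair : ∀ {κ ν : Cardinal} → κ ≤ᶜ max → ν ≤ᶜ max → (κ ×ₛ ν) ≤ᶜ max
  pair i j = Compose.injection (i ×-injection j) (×ₛ-injection em ac max ℕ≤max)

  code : Index em divergent unbounded ≤ᶜ max
  code = pair (pair 𝒜≤max ℬ≤max) (pair 𝒜≤max ℕ≤max)
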